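{- The randomized algorithm MIX-R for buffer management with bounded delay is $\frac{e}{e-1}$-competitive against an adaptive adversary: for every adaptively created instance $I$ and every answering entity $\mathrm{ADV}$, $$\mathbb{E}[\mathcal{G}_{\text{MIX-R}}(I)]\ \ge\ \Bigl(1-\frac1e\Bigr)\cdot\mathbb{E}[\mathcal{G}_{\mathrm{ADV}}(I)].$$
   Context: **Problem (buffer management with bounded delay).** Time is divided into unit steps; step $t$ corresponds to the interval $(t,t+1)$. A packet is $(w,d)$ with weight $w>0$ and relative deadline $d$ (a positive integer at injection), the number of steps after which it expires; distinct packets may have equal weight and deadline. Buffers are initially empty. Before each step any finite set of packets may be injected, into both the algorithm's and $\mathrm{ADV}$'s buffers. In step $t$ the algorithm and $\mathrm{ADV}$ independently each choose and transmit at most one packet from their own buffer; a transmitted packet is removed from the buffer of the party that transmitted it. At time $t+1$ the relative deadlines of all remaining packets are decremented by $1$, packets whose relative deadline reaches $0$ expire and are removed from both buffers, and then the adversary injects any finite set of packets and step $t+1$ begins. A packet is pending for a party if it has been released and has neither expired nor been transmitted by that party. The gain $\mathcal{G}_X(I)$ of $X$ on instance $I$ (the sequence of injected packets) is the total weight of packets transmitted by $X$. **Adaptive(-online) adversary.** The packets injected at a given time may depend on the algorithm's (random) behavior up to that time. The adversary also provides an answering entity $\mathrm{ADV}$ that creates its own solution in parallel with the algorithm and cannot change it afterwards: its transmission in step $t$ is chosen without knowledge of the algorithm's random choice in step $t$ or later. $\mathrm{ADV}$ is deterministic (without loss of generality), but since the algorithm is randomized, so is $I$. An algorithm $\mathrm{ALG}$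 is $R$-competitive against an adaptive adversary if for any adaptively created instance $I$ and any answering entity $\mathrm{ADV}$, $\mathbb{E}[\mathcal{G}_{\mathrm{ALG}}(I)]\ge \frac1R\,\mathbb{E}[\mathcal{G}_{\mathrm{ADV}}(I)]$ (no additive constant). **Dominance.** A pending packet $a=(w_a,d_a)$ is dominated by a pending packet $b=(w_b,d_b)$ if $w_a\le w_b$ and $d_a\ge d_b$; it is strictly dominated by $b$ if moreover one of these inequalities is strict. A packet is (strictly) dominated if some pending packet (strictly) dominates it. **Algorithm MIX-R (one step).** If there are no pending packets, do nothing. Otherwise set $m\leftarrow 0$, $n\leftarrow 0$, $r\leftarrow 1$, $H_0\leftarrow$ the set of packets pending for the algorithm, and $h_0=(w_0,d_0)\leftarrow$ a heaviest packet of $H_0$. While $H_m\neq\emptyset$, do: 1. $m\leftarrow m+1$; 2. $h_m=(w_m,d_m)\leftarrow$ a heaviest not strictly dominated packet from $H_{m-1}$; 3. $p_{m-1}\leftarrow\min\{1-\frac{w_m}{w_{m-1}},\,r\}$; 4. $r\leftarrow r-p_{m-1}$; 5. if $r>0$ then $n\leftarrow n+1$; 6. $H_m\leftarrow\{x\in H_{m-1} : x\text{ is not dominated by }h_m\}$. After the loop set $p_m\leftarrow r$. Transmit a packet chosen (with fresh randomness) from $h_1,\dots,h_n$ with probability distribution $p_1,\dots,p_n$. (Always $p_0=0$.) -}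

module Defs where

open import Algebra.Bundles using (CommutativeRing)
open import Algebra.Structures using (IsCommutativeRing)
import Algebra.Construct.NaturalChoice.Min as NaturalMin
import Algebra.Properties.Ring as RingProperties
import Algebra.Properties.Semiring.Mult as SemiringMult
open import Data.Bool.Base using (if_then_else_)
open import Data.Fin.Base using (Fin; toℕ)
open import Data.List.Base
  using (List; []; _∷_; _++_; map; mapMaybe; foldr; filter; take; length;
         lookup; removeAt; allFin)
open import Data.List.Membership.Propositional using (_∈_)
open import Data.List.Relation.Unary.All using (All)
open import Data.Maybe.Base as Maybe using (Maybe; just; nothing)
open import Data.Nat.Base as ℕ using (ℕ; zero; suc; _!)
import Data.Nat.Properties as ℕₚ
open import Data.Product.Base using (∃; _×_; _,_; proj₁; proj₂; map₂)
open import Data.Sum.Base using (_⊎_; inj₁; inj₂)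
open import Relation.Binary.Bundles using (DecTotalOrder)
open import Relation.Binary.Structures using (IsDecTotalOrder)
import Relation.Binary.Construct.NonStrictToStrict as NonStrictToStrict
open import Relation.Binary.PropositionalEquality
  using (_≡_; _≢_; refl; sym; trans; cong; subst; subst₂)
open import Relation.Nullary.Decidable using (Dec; does; ¬?; _×-dec_)
open import Relation.Nullary.Negation using (¬_)

-- The standard library has no real numbers.  They are axiomatised, with
-- classical (decidable) order, as a Dedekind-complete ordered field; this
-- determines them up to isomorphism.
record Reals : Set₁ where
  infix  8 -_ _⁻¹
  infixl 7 _*_
  infixl 6 _+_
  infix  4 _≤_
  field
    ℝ   : Set
    _+_ : ℝ → ℝ → ℝ
    _*_ : ℝ → ℝ → ℝ
    -_  : ℝ → ℝ
    0#  : ℝ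
    1#  : ℝ
    -- Total, but unconstrained at 0#.
    _⁻¹ : ℝ → ℝ
    _≤_ : ℝ → ℝ → Set

    isCommutativeRing : IsCommutativeRing _≡_ _+_ _*_ -_ 0# 1#
    0≢1               : 0# ≢ 1#
    *-inverseʳ        : ∀ {x} → x ≢ 0# → x * x ⁻¹ ≡ 1#

    isDecTotalOrder : IsDecTotalOrder _≡_ _≤_
    +-monoʳ-≤       : ∀ x {y z} → y ≤ z → x + y ≤ x + z
    *-nonNeg        : ∀ {x y} → 0# ≤ x → 0# ≤ y → 0# ≤ x * y

  UpperBound : (ℝ → Set) → ℝ → Set
  UpperBound P b = ∀ x → P x → x ≤ b

  IsSupremum : (ℝ → Set) → ℝ → Set
  IsSupremum P s = UpperBound P s × (∀ b → UpperBound P b → s ≤ b)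

  field
    complete : (P : ℝ → Set) → ∃ P → ∃ (UpperBound P) → ∃ (IsSupremum P)

  commutativeRing : CommutativeRing _ _
  commutativeRing = record { isCommutativeRing = isCommutativeRing }

  decTotalOrder : DecTotalOrder _ _ _
  decTotalOrder = record { isDecTotalOrder = isDecTotalOrder }

  open IsDecTotalOrder isDecTotalOrder public
    using (_≤?_; _≟_)
    renaming (refl to ≤-refl; trans to ≤-trans; total to ≤-total; reflexive to ≤-reflexive)

  open NonStrictToStrict _≡_ _≤_ public using (_<_)

  _<?_ : ∀ x y → Dec (x < y)
  _<?_ = NonStrictToStrict.<-decidable _≡_ _≤_ _≟_ _≤?_

  open NaturalMin (DecTotalOrder.totalOrder decTotalOrder) public
    using () renaming (_⊓_ to min)

  infixl 6 _-_
  _-_ : ℝ → ℝ → ℝ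
  x - y = x + - y

  infixl 7 _/_
  _/_ : ℝ → ℝ → ℝ
  x / y = x * y ⁻¹

  fromℕ : ℕ → ℝ
  fromℕ n = SemiringMult._×_ (CommutativeRing.semiring commutativeRing) n 1#

-- Euler's number as the supremum of the (increasing) partial sums of ∑ 1/k!.
module Euler (R : Reals) where
  open Reals R
  open CommutativeRing commutativeRing
    using (+-assoc; +-comm; +-identityˡ; +-identityʳ; -‿inverseˡ;
           *-assoc; *-comm; *-identityˡ; *-identityʳ; distribʳ)

  -- ∑_{k<n} 1/k!
  expSum : ℕ → ℝ
  expSum zero    = 0#
  expSum (suc n) = expSum n + fromℕ (n !) ⁻¹

  PartialSum : ℝ → Set
  PartialSum x = ∃ λ n → x ≡ expSum n

  private
    open RingProperties (CommutativeRing.ring commutativeRing)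
      using (-‿distribˡ-*; -‿distribʳ-*; -‿involutive)

    +-monoˡ-≤ : ∀ x {y z} → y ≤ z → y + x ≤ z + x
    +-monoˡ-≤ x {y} {z} y≤z = subst₂ _≤_ (+-comm x y) (+-comm x z) (+-monoʳ-≤ x y≤z)

    0≤-neg : ∀ {x} → x ≤ 0# → 0# ≤ - x
    0≤-neg {x} x≤0 = subst₂ _≤_ (-‿inverseˡ x) (+-identityʳ (- x)) (+-monoʳ-≤ (- x) x≤0)

    neg-*-neg : ∀ x y → - x * - y ≡ x * y
    neg-*-neg x y = trans (sym (-‿distribˡ-* x (- y)))
      (trans (cong -_ (sym (-‿distribʳ-* x y))) (-‿involutive (x * y)))

    0≤x² : ∀ x → 0# ≤ x * x
    0≤x² x with ≤-total 0# x
    ... | inj₁ 0≤x = *-nonNeg 0≤x 0≤x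
    ... | inj₂ x≤0 = subst (0# ≤_) (neg-*-neg x x) (*-nonNeg (0≤-neg x≤0) (0≤-neg x≤0))

    0≤1 : 0# ≤ 1#
    0≤1 = subst (0# ≤_) (*-identityˡ 1#) (0≤x² 1#)

    0≤fromℕ : ∀ n → 0# ≤ fromℕ n
    0≤fromℕ zero    = ≤-refl
    0≤fromℕ (suc n) = ≤-trans (0≤fromℕ n)
      (subst (_≤ 1# + fromℕ n) (+-identityˡ (fromℕ n)) (+-monoˡ-≤ (fromℕ n) 0≤1))

    1≤fromℕ-suc : ∀ n → 1# ≤ fromℕ (suc n)
    1≤fromℕ-suc n = subst (_≤ 1# + fromℕ n) (+-identityʳ 1#) (+-monoʳ-≤ 1# (0≤fromℕ n))

    fromℕ≢0 : ∀ n → .{{ℕ.NonZero n}} → fromℕ n ≢ 0#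
    fromℕ≢0 (suc n) eq = 0≢1
      (IsDecTotalOrder.antisym isDecTotalOrder 0≤1 (subst (1# ≤_) eq (1≤fromℕ-suc n)))

    0≤⁻¹ : ∀ {x} → 0# ≤ x → x ≢ 0# → 0# ≤ x ⁻¹
    0≤⁻¹ {x} 0≤x x≢0 = subst (0# ≤_) eq (*-nonNeg 0≤x (0≤x² (x ⁻¹)))
      where
      eq : x * (x ⁻¹ * x ⁻¹) ≡ x ⁻¹
      eq = trans (sym (*-assoc x (x ⁻¹) (x ⁻¹)))
        (trans (cong (_* x ⁻¹) (*-inverseʳ x≢0)) (*-identityˡ (x ⁻¹)))

    t : ℕ → ℝ
    t n = fromℕ (n !) ⁻¹

    !≢0 : ∀ n → fromℕ (n !) ≢ 0#
    !≢0 n = fromℕ≢0 (n !) {{n ℕₚ.!≢0}}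

    0≤t : ∀ n → 0# ≤ t n
    0≤t n = 0≤⁻¹ (0≤fromℕ (n !)) (!≢0 n)

    t-suc : ∀ n → fromℕ (suc n) * t (suc n) ≡ t n
    t-suc n = trans (sym (*-identityˡ _))
      (trans (cong (_* (a * t (suc n))) (sym (trans (*-comm (t n) f) (*-inverseʳ (!≢0 n)))))
      (trans (*-assoc (t n) f (a * t (suc n)))
      (trans (cong (t n *_) (trans (sym (*-assoc f a (t (suc n))))
        (trans (cong (_* t (suc n)) (trans (*-comm f a)
                 (sym (SemiringMult.×1-homo-* (CommutativeRing.semiring commutativeRing) (suc n) (n !)))))
               (*-inverseʳ (!≢0 (suc n))))))
      (*-identityʳ (t n)))))
      where
      a = fromℕ (suc n)
      f = fromℕ (n !)

    2t≤t : ∀ n → t (suc (suc n)) + t (suc (suc n)) ≤ t (suc n)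
    2t≤t n = subst₂ _≤_
      (+-identityˡ (s + s))
      (trans (+-comm (fromℕ n * s) (s + s)) eq)
      (+-monoˡ-≤ (s + s) (*-nonNeg (0≤fromℕ n) (0≤t (suc (suc n)))))
      where
      s = t (suc (suc n))
      eq : (s + s) + fromℕ n * s ≡ t (suc n)
      eq = trans (+-assoc s s (fromℕ n * s))
        (trans (cong (s +_) (trans (cong (_+ fromℕ n * s) (sym (*-identityˡ s)))
                                   (sym (distribʳ s 1# (fromℕ n)))))
        (trans (cong (_+ fromℕ (suc n) * s) (sym (*-identityˡ s)))
        (trans (sym (distribʳ s 1# (fromℕ (suc n)))) (t-suc (suc n)))))

    bound : ℝ
    bound = expSum 2 + t 1

    sum+t≤bound : ∀ n → expSum (suc (suc n)) + t (suc n) ≤ bound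
    sum+t≤bound zero    = ≤-refl
    sum+t≤bound (suc n) = ≤-trans
      (subst (_≤ expSum (suc (suc n)) + t (suc n))
             (sym (+-assoc (expSum (suc (suc n))) (t (suc (suc n))) (t (suc (suc n)))))
             (+-monoʳ-≤ (expSum (suc (suc n))) (2t≤t n)))
      (sum+t≤bound n)

    x≤x+t : ∀ x n → x ≤ x + t n
    x≤x+t x n = subst (_≤ x + t n) (+-identityʳ x) (+-monoʳ-≤ x (0≤t n))

    expSum≤bound : ∀ n → expSum n ≤ bound
    expSum≤bound zero          =
      ≤-trans (x≤x+t (expSum 0) 0) (≤-trans (x≤x+t (expSum 1) 1) (x≤x+t (expSum 2) 1))
    expSum≤bound (suc zero)    = ≤-trans (x≤x+t (expSum 1) 1) (x≤x+t (expSum 2) 1)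
    expSum≤bound (suc (suc n)) = ≤-trans (x≤x+t (expSum (suc (suc n))) (suc n)) (sum+t≤bound n)

  e-sup : ∃ (IsSupremum PartialSum)
  e-sup = complete PartialSum (0# , 0 , refl) (bound , λ { x (n , refl) → expSum≤bound n })

  e : ℝ
  e = proj₁ e-sup

module BufferManagement (R : Reals) where
  open Reals R

  record Packet : Set where
    field
      weight     : ℝ
      deadline   : ℕ          -- relative to the current time
      weight>0   : 0# < weight
      deadline>0 : 0 ℕ.< deadline

  open Packet public

  -- A finite multiset; packets of equal weight and deadline are told apart
  -- by their positions.
  Buffer : Set
  Buffer = List Packet

  -- A transmission of at most one packet of the buffer.
  Move : Buffer → Set
  Move b = Maybe (Fin (length b))

  gain : (b : Buffer) → Move b → ℝ
  gain b nothing  = 0#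
  gain b (just i) = weight (lookup b i)

  send : (b : Buffer) → Move b → Buffer
  send b nothing  = b
  send b (just i) = removeAt b i

  -- Decrement the relative deadline; nothing if the packet expires.
  age : Packet → Maybe Packet
  age record { deadline = suc (suc d) ; weight = w ; weight>0 = w>0 } =
    just (record { weight = w ; deadline = suc d ; weight>0 = w>0 ; deadline>0 = ℕ.z<s })
  age _ = nothing

  -- The state of a party's buffer between its transmission in a step and the
  -- injections preceding the next step.
  afterStep : (b : Buffer) → Move b → Buffer
  afterStep b m = mapMaybe age (send b m)

  record Distribution (A : Set) : Set where
    field
      outcomes    : List (ℝ × A)
      nonNegative : All (λ o → 0# ≤ proj₁ o) outcomes
      total≡1     : foldr (λ o s → proj₁ o + s) 0# outcomes ≡ 1#

  open Distribution public

  𝔼 : ∀ {A} → Distribution A → (A → ℝ) → ℝ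
  𝔼 D f = foldr (λ o s → proj₁ o * f (proj₂ o) + s) 0# (outcomes D)

  -- What happened in the preceding steps, the most recent one first: the
  -- packets injected just before the step and the position in its buffer of
  -- the packet that the algorithm transmitted (if any).  As the adversary and
  -- ADV are deterministic, this determines the whole course of the game.
  History : Set
  History = List (List Packet × Maybe ℕ)

  -- An algorithm picks its move at random, with fresh randomness in each step,
  -- from the past and its present buffer (after the injections).
  Algorithm : Set
  Algorithm = History → (b : Buffer) → Distribution (Move b)

  Injections : Set
  Injections = History → List Packet

  -- The history excludes the algorithm's move in the present step.  ADV's
  -- buffer is a function of the history and the injection strategy; it is an
  -- argument so that only packets pending for ADV can be transmitted.
  AnsweringEntity : Set
  AnsweringEntity = History → (b : Buffer) → Move b

  data Party : Set where
    ALG ADV : Party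

  -- Expected gain of party X during the next T steps, given the past and the
  -- two buffers as they are before the next injections.
  expectedGainFrom : Algorithm → Injections → AnsweringEntity → Party →
                     (T : ℕ) → History → (bALG bADV : Buffer) → ℝ
  expectedGainFrom alg inj adv X zero    h bALG bADV = 0#
  expectedGainFrom alg inj adv X (suc T) h bALG bADV =
    𝔼 (alg h b) λ m →
      stepGain X m +
      expectedGainFrom alg inj adv X T ((inj h , Maybe.map toℕ m) ∷ h)
                       (afterStep b m) (afterStep b′ m′)
    where
    b : Buffer
    b = bALG ++ inj h

    b′ : Buffer
    b′ = bADV ++ inj h

    m′ : Move b′
    m′ = adv h b′

    stepGain : Party → Move b → ℝ
    stepGain ALG m = gain b m
    stepGain ADV m = gain b′ m′

  expectedGain : Algorithm → Injections → AnsweringEntity → Party → ℕ → ℝ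
  expectedGain alg inj adv X T = expectedGainFrom alg inj adv X T [] [] []

  -- sup f ≤ sup g in [-∞,∞].
  _≤ˢᵘᵖ_ : (f g : ℕ → ℝ) → Set
  f ≤ˢᵘᵖ g = ∀ B → (∀ T → g T ≤ B) → ∀ T → f T ≤ B

  -- An instance need not be finite.  The gain in the first T steps is
  -- nondecreasing in T, so by monotone convergence the expected gain 𝔼[G_X(I)]
  -- is the supremum over T of the expected gain in T steps (possibly ∞).  If the
  -- packets are injected in boundedly many steps, the supremum is attained.
  _-Competitive_ : ℝ → Algorithm → Set
  ρ -Competitive alg =
    (inj : Injections) (adv : AnsweringEntity) →
    (λ T → (1# / ρ) * expectedGain alg inj adv ADV T) ≤ˢᵘᵖ expectedGain alg inj adv ALG

  -- a is (strictly) dominated by b.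
  DominatedBy : (a b : Packet) → Set
  DominatedBy a b = weight a ≤ weight b × deadline b ℕ.≤ deadline a

  StrictlyDominatedBy : (a b : Packet) → Set
  StrictlyDominatedBy a b =
    DominatedBy a b × (weight a < weight b ⊎ deadline b ℕ.< deadline a)

  dominatedBy? : ∀ a b → Dec (DominatedBy a b)
  dominatedBy? a b = weight a ≤? weight b ×-dec deadline b ℕₚ.≤? deadline a

  -- One step of MIX-R with pending packets b; packets are named by positions.
  module MIX-R-Step (b : Buffer) where
    Pos : Set
    Pos = Fin (length b)

    pkt : Pos → Packet
    pkt = lookup b

    w : Pos → ℝ
    w x = weight (pkt x)

    StrictlyDominated : Pos → Set
    StrictlyDominated x = ∃ λ y → StrictlyDominatedBy (pkt x) (pkt y)

    HeaviestAmong : (Pos → Set) → Pos → Set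
    HeaviestAmong P x = P x × (∀ y → P y → w y ≤ w x)

    removeDominated : Pos → List Pos → List Pos
    removeDominated x = filter (λ y → ¬? (dominatedBy? (pkt y) (pkt x)))

    -- Loop hₘ r Hₘ out k: started after m iterations in a state with
    -- the given hₘ, r and Hₘ, the while loop (followed by pₘ ← r) can produce
    -- out = (pₘ , hₘ) ∷ (pₘ₊₁ , hₘ₊₁) ∷ …, incrementing n exactly k times.
    -- It is a relation as ties for the heaviest packet are broken arbitrarily.
    data Loop : Pos → ℝ → List Pos → List (ℝ × Pos) → ℕ → Set where
      exit : ∀ {h r} → Loop h r [] ((r , h) ∷ []) 0

      iterate : ∀ {h r H h′ out k} →
        HeaviestAmong (λ x → x ∈ H × ¬ StrictlyDominated x) h′ →
        let p  = min (1# - w h′ / w h) r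
            r′ = r - p
        in Loop h′ r′ (removeDominated h′ H) out k →
           Loop h r H ((p , h) ∷ out) (if does (0# <? r′) then suc k else k)

  open MIX-R-Step using (HeaviestAmong; Loop)

  -- The possible distributions of the move of MIX-R with pending packets b.
  data MIX-R-Move : (b : Buffer) → List (ℝ × Move b) → Set where
    idle : MIX-R-Move [] ((1# , nothing) ∷ [])

    transmit : ∀ {b h₀ p₀ out n} →
      HeaviestAmong b (_∈ allFin (length b)) h₀ →
      Loop b h₀ 1# (allFin (length b)) ((p₀ , h₀) ∷ out) n →
      MIX-R-Move b (map (map₂ just) (take n out))

  IsMIX-R : Algorithm → Set
  IsMIX-R alg = ∀ h b → MIX-R-Move b (outcomes (alg h b))

-- Idea.  The adversary's buffer is kept, up to a debt, a part of the algorithm's: each of its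
-- packets is either forgone, at the price of its weight, or exchanged for a packet of the
-- algorithm expiring no earlier, at the price of the loss in weight.  Suppose that in a step the
-- adversary (so imitated) sends y and MIX-R sends f.  The new debt is penalty y f, which is at
-- most w_f, and at most max (w_f - w_y) 0 if f expires no later than y.  Since
-- pᵢ wᵢ = wᵢ - wᵢ₊₁ for i < n, the sum w_y + E[penalty y f] telescopes to at most w₁.  The
-- algorithm gains E[w_f] = w₁ - wₙ (1 - pₙ) in expectation, where wₙ = w₁ ∏ (1 - pᵢ), the product
-- being over i < n.  With E_N(x) = ∑_{k<N} xᵏ/k!, the inequality (1 - p) E_N(u + p) ≤ E_N(u)
-- (the graph of E_N lies above its tangents) gives (w₁ - E[w_f]) E_N(1) ≤ w₁ by induction over
-- the loop, that is, E[w_f] ≥ (1 - 1/e) w₁.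
module Submission where

open import Defs
open import Algebra.Bundles using (CommutativeRing)
open import Algebra.Solver.Ring.AlmostCommutativeRing
  using (fromCommutativeRing; _-Raw-AlmostCommutative⟶_)
import Algebra.Solver.Ring as RingSolver
import Algebra.Construct.NaturalChoice.Min as NaturalMin
import Algebra.Properties.Ring as RingProperties
import Algebra.Properties.AbelianGroup as AbelianGroupProperties
import Algebra.Properties.Semiring.Mult as SemiringMult
import Algebra.Properties.Semiring.Mult.TCOptimised as TCOptimised
open import Data.Bool.Base using (if_then_else_)
open import Data.Integer.Base as ℤ using (ℤ; -[1+_]; _⊖_)
import Data.Integer.Properties as ℤₚ
open import Data.Fin.Base using (Fin; zero; suc; toℕ)
open import Data.List.Base
  using (List; []; _∷_; _++_; map; mapMaybe; catMaybes; foldr; take; length;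
         lookup; removeAt; allFin)
open import Data.List.Membership.Propositional using (_∈_)
open import Data.List.Membership.Propositional.Properties
  using (∈-filter⁺; ∈-filter⁻; ∈-allFin; ∈-∃++)
open import Data.List.Relation.Binary.Permutation.Propositional
  using (_↭_; prep; swap; ↭-refl; ↭-sym; ↭-trans)
open import Data.List.Relation.Binary.Permutation.Propositional.Properties
  using (∈-resp-↭; drop-∷; shift; mapMaybe-↭; ++⁺ʳ; ¬x∷xs↭[])
open import Data.List.Relation.Unary.All using (All; []; _∷_)
open import Data.List.Relation.Unary.Any using (here; there; index)
open import Data.List.Relation.Unary.Any.Properties using (lookup-index)
open import Data.List.Relation.Unary.All.Properties using (map⁻)
open import Data.Maybe.Base as Maybe using (Maybe; just; nothing)
open import Data.Nat.Base as ℕ using (ℕ; zero; suc; _!)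
import Data.Nat.Properties as ℕₚ
open import Data.Product.Base using (∃; ∃₂; _×_; _,_; proj₁; proj₂; map₂)
open import Data.Sum.Base using (_⊎_; inj₁; inj₂)
open import Function.Base using (_∘_)
open import Relation.Binary.Bundles using (DecTotalOrder)
open import Relation.Binary.Consequences using (dec⇒weaklyDec)
open import Relation.Binary.PropositionalEquality
  using (_≡_; _≢_; refl; sym; trans; cong; cong₂; subst; subst₂; module ≡-Reasoning)
open import Relation.Binary.Structures using (IsDecTotalOrder)
open import Relation.Nullary.Decidable using (does; yes; no; ¬?; dec-true; dec-false)
open import Relation.Nullary.Negation using (¬_; contradiction)

-- Integer coefficients for the ring solver.

module IntegerCoefficients (R : Reals) where
  open Reals R
  open CommutativeRing commutativeRing
    using (ring; semiring; +-abelianGroup; +-assoc; +-comm; +-identityˡ; +-identityʳ;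
           -‿inverseʳ)
  open RingProperties ring using (-0#≈0#; -‿involutive; -‿distribˡ-*; -‿distribʳ-*)
  open AbelianGroupProperties +-abelianGroup using (⁻¹-∙-comm)
  open TCOptimised semiring using (1+×; ×-homo-+; ×1-homo-*) renaming (_×_ to _×′_)
  open ≡-Reasoning

  -- Unlike fromℕ 1, fromℕ′ 1 is definitionally 1#, so that the solver's con (ℤ.+ 1) is 1#.
  fromℕ′ : ℕ → ℝ
  fromℕ′ n = n ×′ 1#

  fromℤ : ℤ → ℝ
  fromℤ (ℤ.+ n)    = fromℕ′ n
  fromℤ -[1+ n ] = - fromℕ′ (suc n)

  private
    fromℕ′-+ : ∀ m n → fromℕ′ (m ℕ.+ n) ≡ fromℕ′ m + fromℕ′ n
    fromℕ′-+ = ×-homo-+ 1#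

    cancel-1 : ∀ a b → (1# + a) + - (1# + b) ≡ a + - b
    cancel-1 a b = begin
      (1# + a) + - (1# + b)      ≡⟨ cong₂ _+_ (+-comm 1# a) (sym (⁻¹-∙-comm 1# b)) ⟩
      (a + 1#) + (- 1# + - b)    ≡⟨ +-assoc a 1# _ ⟩
      a + (1# + (- 1# + - b))    ≡⟨ cong (a +_) (sym (+-assoc 1# (- 1#) (- b))) ⟩
      a + ((1# + - 1#) + - b)    ≡⟨ cong (λ z → a + (z + - b)) (-‿inverseʳ 1#) ⟩
      a + (0# + - b)             ≡⟨ cong (a +_) (+-identityˡ (- b)) ⟩
      a + - b                    ∎

  fromℤ-⊖ : ∀ m n → fromℤ (m ⊖ n) ≡ fromℕ′ m + - fromℕ′ n
  fromℤ-⊖ zero    zero    = sym (-‿inverseʳ 0#)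
  fromℤ-⊖ zero    (suc n) = sym (+-identityˡ _)
  fromℤ-⊖ (suc m) zero    = sym (trans (cong (fromℕ′ (suc m) +_) -0#≈0#) (+-identityʳ _))
  fromℤ-⊖ (suc m) (suc n) = trans (cong fromℤ (ℤₚ.[1+m]⊖[1+n]≡m⊖n m n))
    (trans (fromℤ-⊖ m n) (sym (trans
      (cong₂ (λ a b → a + - b) (1+× m 1#) (1+× n 1#)) (cancel-1 (fromℕ′ m) (fromℕ′ n)))))

  fromℤ-+ : ∀ i j → fromℤ (i ℤ.+ j) ≡ fromℤ i + fromℤ j
  fromℤ-+ (ℤ.+ m)    (ℤ.+ n)    = fromℕ′-+ m n
  fromℤ-+ (ℤ.+ m)    -[1+ n ] = fromℤ-⊖ m (suc n)
  fromℤ-+ -[1+ m ] (ℤ.+ n)    = trans (fromℤ-⊖ n (suc m)) (+-comm _ _)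
  fromℤ-+ -[1+ m ] -[1+ n ] = begin
    - fromℕ′ (suc (suc (m ℕ.+ n)))        ≡⟨ cong (-_ ∘ fromℕ′ ∘ suc) (sym (ℕₚ.+-suc m n)) ⟩
    - fromℕ′ (suc m ℕ.+ suc n)            ≡⟨ cong -_ (fromℕ′-+ (suc m) (suc n)) ⟩
    - (fromℕ′ (suc m) + fromℕ′ (suc n))    ≡⟨ sym (⁻¹-∙-comm _ _) ⟩
    - fromℕ′ (suc m) + - fromℕ′ (suc n)    ∎

  fromℤ-neg : ∀ i → fromℤ (ℤ.- i) ≡ - fromℤ i
  fromℤ-neg (ℤ.+ zero)  = sym -0#≈0#
  fromℤ-neg (ℤ.+ suc n) = refl
  fromℤ-neg -[1+ n ]  = sym (-‿involutive _)

  fromℤ-* : ∀ i j → fromℤ (i ℤ.* j) ≡ fromℤ i * fromℤ j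
  fromℤ-* (ℤ.+ m) (ℤ.+ n) = trans (cong fromℤ (sym (ℤₚ.pos-* m n))) (×1-homo-* m n)
  fromℤ-* (ℤ.+ m) -[1+ n ] = begin
    fromℤ (ℤ.+ m ℤ.* -[1+ n ])          ≡⟨ cong fromℤ (sym (ℤₚ.neg-distribʳ-* (ℤ.+ m) (ℤ.+ suc n))) ⟩
    fromℤ (ℤ.- (ℤ.+ m ℤ.* ℤ.+ suc n))     ≡⟨ fromℤ-neg (ℤ.+ m ℤ.* ℤ.+ suc n) ⟩
    - fromℤ (ℤ.+ m ℤ.* ℤ.+ suc n)         ≡⟨ cong -_ (fromℤ-* (ℤ.+ m) (ℤ.+ suc n)) ⟩
    - (fromℕ′ m * fromℕ′ (suc n))       ≡⟨ -‿distribʳ-* _ _ ⟩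
    fromℕ′ m * - fromℕ′ (suc n)         ∎
  fromℤ-* -[1+ m ] (ℤ.+ n) = begin
    fromℤ (-[1+ m ] ℤ.* ℤ.+ n)          ≡⟨ cong fromℤ (sym (ℤₚ.neg-distribˡ-* (ℤ.+ suc m) (ℤ.+ n))) ⟩
    fromℤ (ℤ.- (ℤ.+ suc m ℤ.* ℤ.+ n))     ≡⟨ fromℤ-neg (ℤ.+ suc m ℤ.* ℤ.+ n) ⟩
    - fromℤ (ℤ.+ suc m ℤ.* ℤ.+ n)         ≡⟨ cong -_ (fromℤ-* (ℤ.+ suc m) (ℤ.+ n)) ⟩
    - (fromℕ′ (suc m) * fromℕ′ n)       ≡⟨ -‿distribˡ-* _ _ ⟩
    - fromℕ′ (suc m) * fromℕ′ n         ∎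
  fromℤ-* -[1+ m ] -[1+ n ] = begin
    fromℤ (ℤ.+ suc m ℤ.* ℤ.+ suc n)           ≡⟨ fromℤ-* (ℤ.+ suc m) (ℤ.+ suc n) ⟩
    fromℕ′ (suc m) * fromℕ′ (suc n)         ≡⟨ sym (-‿involutive _) ⟩
    - - (fromℕ′ (suc m) * fromℕ′ (suc n))   ≡⟨ cong -_ (-‿distribˡ-* _ _) ⟩
    - (- fromℕ′ (suc m) * fromℕ′ (suc n))   ≡⟨ -‿distribʳ-* _ _ ⟩
    - fromℕ′ (suc m) * - fromℕ′ (suc n)     ∎

  -- The abstract reals do not compute. With coefficients in ℤ the solver can compare numerals by
  -- evaluation.
  fromℤ-homomorphism : ℤ.+-*-rawRing -Raw-AlmostCommutative⟶ fromCommutativeRing commutativeRing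
  fromℤ-homomorphism = record
    { ⟦_⟧    = fromℤ
    ; +-homo = fromℤ-+
    ; *-homo = fromℤ-*
    ; -‿homo = fromℤ-neg
    ; 0-homo = refl
    ; 1-homo = refl
    }

  open RingSolver ℤ.+-*-rawRing (fromCommutativeRing commutativeRing) fromℤ-homomorphism
    (λ i j → Maybe.map (cong fromℤ) (dec⇒weaklyDec ℤₚ._≟_ i j)) public
    using (solve; con; _:=_; _:+_; _:*_; _:-_; :-_)

-- Inequalities and inverses in an ordered field.

module OrderedField (R : Reals) where
  open Reals R
  open CommutativeRing commutativeRing public
    using (+-assoc; +-comm; +-identityˡ; +-identityʳ; *-assoc; *-comm; *-identityˡ; *-identityʳ;
           zeroˡ; zeroʳ; semiring)
  open IsDecTotalOrder isDecTotalOrder public using (antisym)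
  open NaturalMin (DecTotalOrder.totalOrder decTotalOrder) public
    using () renaming (x⊓y≤x to min≤ˡ; x⊓y≤y to min≤ʳ; ⊓-sel to min-sel)
  open IntegerCoefficients R public

  -- The shape x + t ≡ y + s lets a linear consequence s ≤ t of the hypotheses
  -- be turned into x ≤ y by the ring solver.
  ≤-by-difference : ∀ {x y s t} → s ≤ t → x + t ≡ y + s → x ≤ y
  ≤-by-difference {x} {y} {s} {t} s≤t eq = subst₂ _≤_
    (solve 2 (λ x s → (x :- s) :+ s := x) refl x s)
    (trans (solve 3 (λ x s t → (x :- s) :+ t := (x :+ t) :- s) refl x s t)
      (trans (cong (_- s) eq) (solve 2 (λ y s → (y :+ s) :- s := y) refl y s)))
    (+-monoʳ-≤ (x - s) s≤t)

  +-mono-≤ : ∀ {a b c d} → a ≤ b → c ≤ d → a + c ≤ b + d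
  +-mono-≤ {a} {b} {c} {d} a≤b c≤d = ≤-trans (+-monoʳ-≤ a c≤d)
    (subst₂ _≤_ (+-comm d a) (+-comm d b) (+-monoʳ-≤ d a≤b))

  0≤-difference : ∀ {x y} → x ≤ y → 0# ≤ y - x
  0≤-difference {x} {y} x≤y = ≤-by-difference x≤y
    (solve 2 (λ x y → con (ℤ.+ 0) :+ y := (y :- x) :+ x) refl x y)

  +-nonNeg : ∀ {x y} → 0# ≤ x → 0# ≤ y → 0# ≤ x + y
  +-nonNeg {x} {y} 0≤x 0≤y = subst (_≤ x + y) (+-identityˡ 0#) (+-mono-≤ 0≤x 0≤y)

  x≤x+y : ∀ {x y} → 0# ≤ y → x ≤ x + y
  x≤x+y {x} {y} 0≤y = subst (_≤ x + y) (+-identityʳ x) (+-monoʳ-≤ x 0≤y)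

  *-monoˡ-≤ : ∀ {a x y} → 0# ≤ a → x ≤ y → a * x ≤ a * y
  *-monoˡ-≤ {a} {x} {y} 0≤a x≤y = ≤-by-difference (*-nonNeg 0≤a (0≤-difference x≤y))
    (solve 3 (λ a x y → a :* x :+ a :* (y :- x) := a :* y :+ con (ℤ.+ 0)) refl a x y)

  0≤x² : ∀ x → 0# ≤ x * x
  0≤x² x with ≤-total 0# x
  ... | inj₁ 0≤x = *-nonNeg 0≤x 0≤x
  ... | inj₂ x≤0 = subst (0# ≤_)
    (solve 1 (λ x → (con (ℤ.+ 0) :- x) :* (con (ℤ.+ 0) :- x) := x :* x) refl x)
    (*-nonNeg (0≤-difference x≤0) (0≤-difference x≤0))

  0≤1 : 0# ≤ 1#
  0≤1 = subst (0# ≤_) (*-identityˡ 1#) (0≤x² 1#)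

  0<1 : 0# < 1#
  0<1 = 0≤1 , 0≢1

  ≰⇒≥ : ∀ {x y} → ¬ (x ≤ y) → y ≤ x
  ≰⇒≥ {x} {y} x≰y with ≤-total x y
  ... | inj₁ x≤y = contradiction x≤y x≰y
  ... | inj₂ y≤x = y≤x

  ≮⇒≥ : ∀ {x y} → ¬ (x < y) → y ≤ x
  ≮⇒≥ {x} {y} x≮y with x ≟ y
  ... | yes refl = ≤-refl
  ... | no x≢y   = ≰⇒≥ λ x≤y → x≮y (x≤y , x≢y)

  <-≤-trans : ∀ {x y z} → x < y → y ≤ z → x < z
  <-≤-trans (x≤y , x≢y) y≤z = ≤-trans x≤y y≤z , λ { refl → x≢y (antisym x≤y y≤z) }

  positive⇒nonZero : ∀ {x} → 0# < x → x ≢ 0#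
  positive⇒nonZero (_ , 0≢x) x≡0 = 0≢x (sym x≡0)

  /-*-cancel : ∀ {x} y → x ≢ 0# → y / x * x ≡ y
  /-*-cancel {x} y x≢0 = trans (*-assoc y (x ⁻¹) x)
    (trans (cong (y *_) (trans (*-comm (x ⁻¹) x) (*-inverseʳ x≢0))) (*-identityʳ y))

  *-cancelˡ-≡ : ∀ {a x y} → a ≢ 0# → a * x ≡ a * y → x ≡ y
  *-cancelˡ-≡ {a} {x} {y} a≢0 eq = trans (sym (lemma x)) (trans (cong (_* a ⁻¹) eq) (lemma y))
    where
    lemma : ∀ z → a * z * a ⁻¹ ≡ z
    lemma z = trans (solve 3 (λ a z i → a :* z :* i := a :* i :* z) refl a z (a ⁻¹))
      (trans (cong (_* z) (*-inverseʳ a≢0)) (*-identityˡ z))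

  *-cancelˡ-≤ : ∀ {a x y} → 0# < a → a * x ≤ a * y → x ≤ y
  *-cancelˡ-≤ {a} {x} {y} 0<a ax≤ay with ≤-total x y
  ... | inj₁ x≤y = x≤y
  ... | inj₂ y≤x = ≤-reflexive (*-cancelˡ-≡ (positive⇒nonZero 0<a)
          (antisym ax≤ay (*-monoˡ-≤ (proj₁ 0<a) y≤x)))

  -- ⁻¹ is unconstrained at 0#, hence the side conditions.
  ⁻¹-distrib-* : ∀ {x y} → x ≢ 0# → y ≢ 0# → x * y ≢ 0# → (x * y) ⁻¹ ≡ x ⁻¹ * y ⁻¹
  ⁻¹-distrib-* {x} {y} x≢0 y≢0 xy≢0 = *-cancelˡ-≡ xy≢0 (trans (*-inverseʳ xy≢0) (sym
    (trans (solve 4 (λ x y i j → x :* y :* (i :* j) := (x :* i) :* (y :* j)) refl x y (x ⁻¹) (y ⁻¹))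
      (trans (cong₂ _*_ (*-inverseʳ x≢0) (*-inverseʳ y≢0)) (*-identityˡ 1#)))))

  0≤fromℕ : ∀ n → 0# ≤ fromℕ n
  0≤fromℕ zero    = ≤-refl
  0≤fromℕ (suc n) = +-nonNeg 0≤1 (0≤fromℕ n)

  0<fromℕ : ∀ n → .{{ℕ.NonZero n}} → 0# < fromℕ n
  0<fromℕ (suc n) = <-≤-trans 0<1 (x≤x+y (0≤fromℕ n))

-- The truncated exponential series and the passage to e.

module ExponentialSeries (R : Reals) where
  open Reals R
  open Euler R
  open OrderedField R

  -- This is xᵏ/k!. Building it from the ratio of consecutive terms gives `expTerm-suc`, a
  -- recurrence free of inverses, at once.
  expTerm : ℝ → ℕ → ℝ
  expTerm x zero    = 1#
  expTerm x (suc k) = x * expTerm x k / fromℕ (suc k)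

  expPoly : ℕ → ℝ → ℝ
  expPoly zero    x = 0#
  expPoly (suc n) x = expPoly n x + expTerm x n

  expTerm-suc : ∀ x k → fromℕ (suc k) * expTerm x (suc k) ≡ x * expTerm x k
  expTerm-suc x k = trans (*-comm _ _) (/-*-cancel _ (positive⇒nonZero (0<fromℕ (suc k))))

  expTerm-nonNeg : ∀ {x} → 0# ≤ x → ∀ k → 0# ≤ expTerm x k
  expTerm-nonNeg 0≤x zero    = 0≤1
  expTerm-nonNeg {x} 0≤x (suc k) = *-cancelˡ-≤ (0<fromℕ (suc k)) (subst₂ _≤_
    (sym (zeroʳ _)) (sym (expTerm-suc x k)) (*-nonNeg 0≤x (expTerm-nonNeg 0≤x k)))

  expTerm-1 : ∀ k → expTerm 1# k ≡ fromℕ (k !) ⁻¹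
  expTerm-1 zero    = *-cancelˡ-≡ 1≢0 (trans (cong (_* 1#) (+-identityʳ 1#))
    (trans (*-identityˡ 1#) (sym (*-inverseʳ 1≢0))))
    where 1≢0 = positive⇒nonZero (0<fromℕ 1)
  expTerm-1 (suc k) = trans (cong (_/ fromℕ (suc k)) (trans (*-identityˡ _) (expTerm-1 k)))
    (trans (*-comm _ _) (trans (sym (⁻¹-distrib-* (≢0 (suc k)) k!≢0 (λ eq → k+1!≢0 (trans homo eq))))
      (cong _⁻¹ (sym homo))))
    where
    ≢0 : ∀ n → .{{ℕ.NonZero n}} → fromℕ n ≢ 0#
    ≢0 n = positive⇒nonZero (0<fromℕ n)
    k!≢0 = ≢0 (k !) {{k ℕₚ.!≢0}}
    k+1!≢0 = ≢0 (suc k !) {{suc k ℕₚ.!≢0}}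
    homo : fromℕ (suc k !) ≡ fromℕ (suc k) * fromℕ (k !)
    homo = SemiringMult.×1-homo-* semiring (suc k) (k !)

  expPoly-1 : ∀ n → expPoly n 1# ≡ expSum n
  expPoly-1 zero    = refl
  expPoly-1 (suc n) = cong₂ _+_ (expPoly-1 n) (expTerm-1 n)

  expTerm-0 : ∀ k → expTerm 0# (suc k) ≡ 0#
  expTerm-0 k = *-cancelˡ-≡ (positive⇒nonZero (0<fromℕ (suc k)))
    (trans (expTerm-suc 0# k) (trans (zeroˡ _) (sym (zeroʳ _))))

  expPoly-0 : ∀ n → expPoly (suc n) 0# ≡ 1#
  expPoly-0 zero    = +-identityˡ 1#
  expPoly-0 (suc n) = trans (cong₂ _+_ (expPoly-0 n) (expTerm-0 n)) (+-identityʳ 1#)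

  -- Convexity: xᵏ⁺¹/(k+1)! lies above its tangent at u + p, whose slope is (u+p)ᵏ/k!.
  expTerm-tangent : ∀ {u p} → 0# ≤ u → 0# ≤ p → ∀ k →
    expTerm (u + p) (suc k) ≤ expTerm u (suc k) + p * expTerm (u + p) k
  expTerm-tangent {u} {p} 0≤u 0≤p zero = *-cancelˡ-≤ (0<fromℕ 1) (≤-reflexive
    (trans (expTerm-suc (u + p) 0)
      (trans (solve 2 (λ u p → (u :+ p) :* con (ℤ.+ 1) := u :* con (ℤ.+ 1) :+ p) refl u p)
      (trans (cong (_+ p) (sym (expTerm-suc u 0)))
        (solve 2 (λ U p → (con (ℤ.+ 1) :+ con (ℤ.+ 0)) :* U :+ p :=
          (con (ℤ.+ 1) :+ con (ℤ.+ 0)) :* (U :+ p :* con (ℤ.+ 1))) refl (expTerm u 1) p)))))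
  -- Write t = u + p and Tₖ for the k-th term. After multiplication by k + 2 the left side is u
  -- Tₖ₊₁(t) + p Tₖ₊₁(t). The induction hypothesis bounds the first summand by u Tₖ₊₁(u) + p u
  -- Tₖ(t), and adding p² Tₖ(t) turns p u Tₖ(t) into p t Tₖ(t) = p (k + 1) Tₖ₊₁(t).
  expTerm-tangent {u} {p} 0≤u 0≤p (suc k) = *-cancelˡ-≤ (0<fromℕ (suc (suc k)))
    (≤-by-difference (+-mono-≤ (*-monoˡ-≤ 0≤u (expTerm-tangent 0≤u 0≤p k))
                               (*-nonNeg (*-nonNeg 0≤p 0≤p) (expTerm-nonNeg 0≤t k)))
      (trans (cong (_+ (u * (expTerm u (suc k) + p * expTerm t k) + p * p * expTerm t k))
                   (expTerm-suc t (suc k)))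
        (trans (solve 5 (λ u p U′ A A′ →
            (u :+ p) :* A′ :+ (u :* (U′ :+ p :* A) :+ p :* p :* A) :=
            u :* U′ :+ p :* A′ :+ p :* ((u :+ p) :* A) :+ (u :* A′ :+ con (ℤ.+ 0)))
            refl u p (expTerm u (suc k)) (expTerm t k) (expTerm t (suc k)))
          (sym (trans (solve 5 (λ p K U″ A′ s →
              (con (ℤ.+ 1) :+ K) :* (U″ :+ p :* A′) :+ s :=
              (con (ℤ.+ 1) :+ K) :* U″ :+ p :* A′ :+ p :* (K :* A′) :+ s)
              refl p (fromℕ (suc k)) (expTerm u (suc (suc k))) (expTerm t (suc k)) _)
            (cong₂ (λ a b → a + p * expTerm t (suc k) + p * b + (u * expTerm t (suc k) + 0#))
              (expTerm-suc u (suc k)) (expTerm-suc t k)))))))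
    where
    t = u + p
    0≤t : 0# ≤ t
    0≤t = +-nonNeg 0≤u 0≤p

  -- Sum of the termwise tangent inequalities. The index of the slope is one lower because E_n is
  -- the derivative of E_{n+1}.
  expPoly-tangent : ∀ {u p} → 0# ≤ u → 0# ≤ p → ∀ n →
    expPoly (suc n) (u + p) ≤ expPoly (suc n) u + p * expPoly n (u + p)
  expPoly-tangent {u} {p} 0≤u 0≤p zero    = ≤-reflexive
    (solve 1 (λ p → con (ℤ.+ 0) :+ con (ℤ.+ 1) :=
                    con (ℤ.+ 0) :+ con (ℤ.+ 1) :+ p :* con (ℤ.+ 0)) refl p)
  expPoly-tangent {u} {p} 0≤u 0≤p (suc n) = ≤-by-difference
    (+-mono-≤ (expPoly-tangent 0≤u 0≤p n) (expTerm-tangent 0≤u 0≤p n))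
    (solve 7 (λ p E a Eᵤ b E₀ c →
        E :+ a :+ (Eᵤ :+ p :* E₀ :+ (b :+ p :* c)) := Eᵤ :+ b :+ p :* (E₀ :+ c) :+ (E :+ a))
      refl p (expPoly (suc n) (u + p)) (expTerm (u + p) (suc n)) (expPoly (suc n) u)
      (expTerm u (suc n)) (expPoly n (u + p)) (expTerm (u + p) n))

  -- In the tangent bound p E_n is enlarged to p E_{n+1} and moved to the left. The factor 1 - p is
  -- the one by which the weight drops in an iteration of the loop.
  expPoly-shift : ∀ {u p} → 0# ≤ u → 0# ≤ p → ∀ n →
    (1# - p) * expPoly n (u + p) ≤ expPoly n u
  expPoly-shift {u} {p} 0≤u 0≤p zero    = ≤-reflexive (zeroʳ _)
  expPoly-shift {u} {p} 0≤u 0≤p (suc n) = ≤-by-difference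
    (+-mono-≤ (expPoly-tangent 0≤u 0≤p n) (*-nonNeg 0≤p (expTerm-nonNeg (+-nonNeg 0≤u 0≤p) n)))
    (solve 4 (λ p Eᵤ E a →
        (con (ℤ.+ 1) :- p) :* (E :+ a) :+ (Eᵤ :+ p :* E :+ p :* a) := Eᵤ :+ (E :+ a :+ con (ℤ.+ 0)))
      refl p (expPoly (suc n) u) (expPoly n (u + p)) (expTerm (u + p) n))

  -- The shift from 0 to t, combined with E_n(0) ≤ 1. It serves as the base case of `Run-gain`.
  expPoly-bound : ∀ {t} → 0# ≤ t → ∀ n → (1# - t) * expPoly n t ≤ 1#
  expPoly-bound {t} 0≤t n = ≤-trans
    (subst (λ z → (1# - t) * expPoly n z ≤ expPoly n 0#) (+-identityˡ t) (expPoly-shift ≤-refl 0≤t n))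
    (at-0 n)
    where
    at-0 : ∀ n → expPoly n 0# ≤ 1#
    at-0 zero    = 0≤1
    at-0 (suc n) = ≤-reflexive (expPoly-0 n)

  expPoly≤e : ∀ n → expPoly n 1# ≤ e
  expPoly≤e n = proj₁ (proj₂ e-sup) (expPoly n 1#) (n , expPoly-1 n)

  1<e : 1# < e
  -- The first two terms of the series already give 2 ≤ e.
  1<e = <-≤-trans (x≤x+y 0≤1 , 1≢2)
    (subst (_≤ e) (cong₂ _+_ (+-identityˡ 1#) (expTerm-1≡1)) (expPoly≤e 2))
    where
    two = 1# + 1#
    1≢2 : 1# ≢ two
    1≢2 eq = 0≢1 (trans (solve 0 (con (ℤ.+ 0) := con (ℤ.+ 1) :- con (ℤ.+ 1)) refl)
      (trans (cong (_- 1#) eq)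
        (solve 0 (con (ℤ.+ 1) :+ con (ℤ.+ 1) :- con (ℤ.+ 1) := con (ℤ.+ 1)) refl)))
    expTerm-1≡1 : expTerm 1# 1 ≡ 1#
    expTerm-1≡1 = trans (sym (*-identityˡ _)) (trans (cong (_* expTerm 1# 1) (sym (+-identityʳ 1#)))
      (trans (expTerm-suc 1# 0) (*-identityˡ 1#)))

  0<e : 0# < e
  0<e = <-≤-trans 0<1 (proj₁ 1<e)

  -- This is 1 - 1/e, written exactly as the factor in `_-Competitive_` for the ratio e/(e - 1), so
  -- that the final bound needs no conversion.
  c : ℝ
  c = 1# / (e / (e - 1#))

  c*e : c * e ≡ e - 1#
  c*e = *-cancelˡ-≡ ρ≢0
    (trans (solve 3 (λ ρ c e → ρ :* (c :* e) := c :* ρ :* e) refl ρ c e)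
      (trans (cong (_* e) (/-*-cancel 1# ρ≢0)) (trans (*-identityˡ e) (sym ρ*[e-1]))))
    where
    ρ = e / (e - 1#)
    e-1≢0 : e - 1# ≢ 0#
    e-1≢0 eq = proj₂ 1<e (sym (trans (solve 1 (λ e → e := e :- con (ℤ.+ 1) :+ con (ℤ.+ 1)) refl e)
      (trans (cong (_+ 1#) eq) (+-identityˡ 1#))))
    ρ*[e-1] : ρ * (e - 1#) ≡ e
    ρ*[e-1] = /-*-cancel e e-1≢0
    ρ≢0 : ρ ≢ 0#
    ρ≢0 eq = positive⇒nonZero 0<e
      (trans (sym ρ*[e-1]) (trans (cong (_* (e - 1#)) eq) (zeroˡ _)))

  0≤c : 0# ≤ c
  0≤c = *-cancelˡ-≤ 0<e (subst₂ _≤_ (sym (zeroʳ e)) (trans (sym c*e) (*-comm c e))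
    (0≤-difference (proj₁ 1<e)))

  -- If x > 0, then y / x is an upper bound of the partial sums and hence of their supremum e.
  -- Otherwise e x ≤ 0 ≤ y.
  e*-bound : ∀ {x y} → 0# ≤ y → (∀ n → x * expPoly n 1# ≤ y) → e * x ≤ y
  e*-bound {x} {y} 0≤y bound with 0# <? x
  ... | no x≯0  = ≤-trans (subst (e * x ≤_) (zeroʳ e) (*-monoˡ-≤ (proj₁ 0<e) (≮⇒≥ x≯0))) 0≤y
  ... | yes 0<x = subst₂ _≤_ (*-comm x e) x*[y/x] (*-monoˡ-≤ (proj₁ 0<x)
      (proj₂ (proj₂ e-sup) (y / x) λ { _ (n , refl) → *-cancelˡ-≤ 0<x
        (subst₂ _≤_ (cong (x *_) (expPoly-1 n)) (sym x*[y/x]) (bound n)) }))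
    where
    x*[y/x] : x * (y / x) ≡ y
    x*[y/x] = trans (*-comm x (y / x)) (/-*-cancel y (positive⇒nonZero 0<x))

  -- In the limit the hypothesis reads e (x - s) ≤ x, that is, (e - 1) x ≤ e s, and e - 1 = c e.
  c*-bound : ∀ {x s} → 0# ≤ x → (∀ n → (x - s) * expPoly n 1# ≤ x) → c * x ≤ s
  c*-bound {x} {s} 0≤x bound = *-cancelˡ-≤ 0<e (≤-by-difference (e*-bound 0≤x bound)
    (trans (solve 3 (λ e c x → e :* (c :* x) :+ x := c :* e :* x :+ x) refl e c x)
      (trans (cong (λ z → z * x + x) c*e)
        (solve 3 (λ e x s → (e :- con (ℤ.+ 1)) :* x :+ x := e :* s :+ e :* (x :- s)) refl e x s))))

-- Finite weighted sums.

module WeightedSums (R : Reals) where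
  open Reals R
  open OrderedField R

  -- On the outcomes of a distribution this is `𝔼`. Bare lists are allowed because inductions along
  -- a run meet its tails, whose mass may be below 1.
  weightedSum : ∀ {A : Set} → List (ℝ × A) → (A → ℝ) → ℝ
  weightedSum l f = foldr (λ o s → proj₁ o * f (proj₂ o) + s) 0# l

  total : ∀ {A : Set} → List (ℝ × A) → ℝ
  total = foldr (λ o s → proj₁ o + s) 0#

  module _ {A : Set} where

    weightedSum-mono : ∀ {l : List (ℝ × A)} {f g} → All (λ o → 0# ≤ proj₁ o) l →
      (∀ a → f a ≤ g a) → weightedSum l f ≤ weightedSum l g
    weightedSum-mono []           f≤g = ≤-refl
    weightedSum-mono (0≤p ∷ 0≤ps) f≤g =
      +-mono-≤ (*-monoˡ-≤ 0≤p (f≤g _)) (weightedSum-mono 0≤ps f≤g)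

    weightedSum-+ : ∀ (l : List (ℝ × A)) f g →
      weightedSum l (λ a → f a + g a) ≡ weightedSum l f + weightedSum l g
    weightedSum-+ []            f g = sym (+-identityˡ 0#)
    weightedSum-+ ((p , a) ∷ l) f g = trans (cong (p * (f a + g a) +_) (weightedSum-+ l f g))
      (solve 5 (λ p x y s t → p :* (x :+ y) :+ (s :+ t) := p :* x :+ s :+ (p :* y :+ t))
        refl p (f a) (g a) _ _)

    weightedSum-* : ∀ (l : List (ℝ × A)) k f →
      weightedSum l (λ a → k * f a) ≡ k * weightedSum l f
    weightedSum-* []            k f = sym (zeroʳ k)
    weightedSum-* ((p , a) ∷ l) k f = trans (cong (p * (k * f a) +_) (weightedSum-* l k f))
      (solve 4 (λ p k x s → p :* (k :* x) :+ k :* s := k :* (p :* x :+ s)) refl p k (f a) _)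

    weightedSum-const : ∀ (l : List (ℝ × A)) k → weightedSum l (λ _ → k) ≡ k * total l
    weightedSum-const []            k = sym (zeroʳ k)
    weightedSum-const ((p , a) ∷ l) k = trans (cong (p * k +_) (weightedSum-const l k))
      (solve 3 (λ p k s → p :* k :+ k :* s := k :* (p :+ s)) refl p k _)

  module _ {A B : Set} (g : A → B) where

    weightedSum-map : ∀ l f → weightedSum (map (map₂ g) l) f ≡ weightedSum l (f ∘ g)
    weightedSum-map []            f = refl
    weightedSum-map ((p , a) ∷ l) f = cong (p * f (g a) +_) (weightedSum-map l f)

    total-map : ∀ l → total (map (map₂ g) l) ≡ total l
    total-map []            = refl
    total-map ((p , a) ∷ l) = cong (p +_) (total-map l)

-- The price of sending one packet in place of another.

module Penalties (R : Reals) where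
  open Reals R
  open OrderedField R
  open BufferManagement R

  0≤weight : ∀ x → 0# ≤ weight x
  0≤weight x = proj₁ (weight>0 x)

  -- What an adversary holding f must be paid to exchange it for y, either by
  -- transmitting y instead of f or by forgoing f.
  penalty : (y f : Packet) → ℝ
  penalty y f with deadline f ℕₚ.≤? deadline y | weight f ≤? weight y
  ... | no  _ | _     = weight f
  ... | yes _ | yes _ = 0#
  ... | yes _ | no  _ = weight f - weight y

  penalty≤weight : ∀ y f → penalty y f ≤ weight f
  penalty≤weight y f with deadline f ℕₚ.≤? deadline y | weight f ≤? weight y
  ... | no  _ | _     = ≤-refl
  ... | yes _ | yes _ = 0≤weight f
  ... | yes _ | no  _ = ≤-by-difference (0≤weight y)
    (solve 2 (λ f y → f :- y :+ y := f :+ con (ℤ.+ 0)) refl (weight f) (weight y))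

  0≤penalty : ∀ y f → 0# ≤ penalty y f
  0≤penalty y f with deadline f ℕₚ.≤? deadline y | weight f ≤? weight y
  ... | no  _ | _       = 0≤weight f
  ... | yes _ | yes _   = ≤-refl
  ... | yes _ | no  f≰y = 0≤-difference (≰⇒≥ f≰y)

  -- As f expires no later than y, it can be exchanged for y, so at most the loss in weight is
  -- charged.
  penalty-urgent : ∀ y f {v} → deadline f ℕ.≤ deadline y → weight f ≤ v → weight y ≤ v →
    penalty y f ≤ v - weight y
  penalty-urgent y f {v} df≤dy f≤v y≤v with deadline f ℕₚ.≤? deadline y | weight f ≤? weight y
  ... | no  df≰dy | _     = contradiction df≤dy df≰dy
  ... | yes _     | yes _ = 0≤-difference y≤v
  ... | yes _     | no  _ = ≤-by-difference f≤v
    (solve 3 (λ f y v → f :- y :+ v := v :- y :+ f) refl (weight f) (weight y) v)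

-- One step of the algorithm: cost and gain along a run.

module MIX-R-Run (R : Reals) (b : BufferManagement.Buffer R) where
  open Reals R
  open OrderedField R
  open WeightedSums R
  open Penalties R
  open ExponentialSeries R
  open BufferManagement R
  open MIX-R-Step b

  d : Pos → ℕ
  d x = deadline (pkt x)

  0<w : ∀ x → 0# < w x
  0<w x = weight>0 (pkt x)

  0≤w : ∀ x → 0# ≤ w x
  0≤w x = 0≤weight (pkt x)

  -- The part of the loop that is reached with positive remaining probability r:
  -- Run h r H out lists the pairs (pₘ , hₘ), …, (pₙ , hₙ).
  data Run : Pos → ℝ → List Pos → List (ℝ × Pos) → Set where
    last : ∀ {h r H p} → p ≡ r → (∀ {j} → j ∈ H → w j ≤ w h - r * w h) →
      Run h r H ((p , h) ∷ [])

    next : ∀ {h h′ r p H H′ out} → w h′ ≤ w h → d h′ ℕ.≤ d h →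
      0# ≤ p → p * w h ≡ w h - w h′ → 0# < r - p →
      (∀ {j} → j ∈ H → DominatedBy (pkt j) (pkt h′) ⊎ j ∈ H′) →
      Run h′ (r - p) H′ out → Run h r H ((p , h) ∷ out)

  Run-total : ∀ {h r H out} → Run h r H out → total out ≡ r
  Run-total (last refl _) = +-identityʳ _
  Run-total (next {r = r} {p} _ _ _ _ _ _ run) = trans (cong (p +_) (Run-total run))
    (solve 2 (λ r p → p :+ (r :- p) := r) refl r p)

  -- Neither weights nor deadlines increase along a run, so every packet in it satisfies the
  -- conditions on i, and the probabilities add up to r.
  Run-bound : ∀ {h r H out f v} → Run h r H out → 0# ≤ r →
    (∀ i → w i ≤ w h → d i ℕ.≤ d h → f i ≤ v) → weightedSum out f ≤ r * v
  Run-bound {h} {r} (last refl _) 0≤r f≤v =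
    subst (_≤ _) (sym (+-identityʳ _)) (*-monoˡ-≤ 0≤r (f≤v h ≤-refl ℕₚ.≤-refl))
  Run-bound {h} {v = v} (next {r = r} {p} w′≤w d′≤d 0≤p _ 0<r′ _ run) _ f≤v = ≤-by-difference
    (+-mono-≤ (*-monoˡ-≤ 0≤p (f≤v h ≤-refl ℕₚ.≤-refl))
      (Run-bound run (proj₁ 0<r′) λ i wi≤w′ di≤d′ → f≤v i (≤-trans wi≤w′ w′≤w) (ℕₚ.≤-trans di≤d′ d′≤d)))
    (solve 4 (λ r p v s → s :+ (p :* v :+ (r :- p) :* v) := r :* v :+ s) refl r p v _)

  remaining≤1 : ∀ {r p} → 0# ≤ p → r ≤ 1# → r - p ≤ 1#
  remaining≤1 {r} {p} 0≤p r≤1 = ≤-by-difference (+-mono-≤ 0≤p r≤1)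
    (solve 2 (λ r p → r :- p :+ (p :+ con (ℤ.+ 1)) := con (ℤ.+ 1) :+ (con (ℤ.+ 0) :+ r)) refl r p)

  -- Let hₖ be the first to dominate j.  As pᵢ wᵢ = wᵢ - wᵢ₊₁, the hᵢ before hₖ cost wₘ - wₖ in
  -- total; from hₖ on all are at least as urgent as j and cost at most wₖ - w j each.
  Run-penalty : ∀ {h r H out j} → Run h r H out → 0# ≤ r → r ≤ 1# → j ∈ H →
    w j + weightedSum out (penalty (pkt j) ∘ pkt) ≤ w h
  Run-penalty-covered : ∀ {h r H out j} → Run h r H out → 0# ≤ r → r ≤ 1# →
    DominatedBy (pkt j) (pkt h) ⊎ j ∈ H → w j + weightedSum out (penalty (pkt j) ∘ pkt) ≤ w h

  -- No packet of the run need dominate j here. Instead `light` gives w j ≤ (1 - r) w h, and the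
  -- remaining expected penalty is at most r w h.
  Run-penalty {h} {r} {j = j} (last refl light) 0≤r r≤1 j∈H = ≤-by-difference
    (+-mono-≤ (light j∈H) (*-monoˡ-≤ 0≤r (penalty≤weight (pkt j) (pkt h))))
    (solve 4 (λ j r x w → j :+ (r :* x :+ con (ℤ.+ 0)) :+ (w :- r :* w :+ r :* w) := w :+ (j :+ r :* x))
      refl (w j) r (penalty (pkt j) (pkt h)) (w h))
  Run-penalty {h} {j = j} (next {h′ = h′} {r} {p} w′≤w _ 0≤p pw 0<r′ split run) 0≤r r≤1 j∈H =
    ≤-by-difference
      (+-mono-≤ (Run-penalty-covered run (proj₁ 0<r′) (remaining≤1 0≤p r≤1) (split j∈H))
                (subst (p * penalty (pkt j) (pkt h) ≤_) pw
                  (*-monoˡ-≤ 0≤p (penalty≤weight (pkt j) (pkt h)))))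
      (solve 5 (λ j x s w w′ → j :+ (x :+ s) :+ (w′ :+ (w :- w′)) := w :+ (j :+ s :+ x))
        refl (w j) _ _ (w h) (w h′))

  Run-penalty-covered run 0≤r r≤1 (inj₂ j∈H) = Run-penalty run 0≤r r≤1 j∈H
  Run-penalty-covered {h} {r} {j = j} run 0≤r r≤1 (inj₁ (wj≤w , d≤dj)) = ≤-by-difference
    (+-mono-≤
      (Run-bound run 0≤r λ i wi≤w di≤d →
        penalty-urgent (pkt j) (pkt i) (ℕₚ.≤-trans di≤d d≤dj) wi≤w wj≤w)
      (*-nonNeg (0≤-difference r≤1) (0≤-difference wj≤w)))
    (solve 4 (λ j s w r → j :+ s :+ (r :* (w :- j) :+ (con (ℤ.+ 1) :- r) :* (w :- j)) :=
                          w :+ (s :+ con (ℤ.+ 0)))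
      refl (w j) _ (w h) r)

  -- Let S be the gain of the tail. As p w h = w h - w h′, the shortfall w h - (p w h + S) is w h′ -
  -- S, the shortfall of the tail. So only the argument of E_n must be raised from r - p to r, at
  -- the price of the factor w h / w h′ = 1 / (1 - p) given by `expPoly-shift`.
  Run-gain : ∀ {h r H out} → Run h r H out → 0# ≤ r → r ≤ 1# → ∀ n →
    (w h - weightedSum out w) * expPoly n r ≤ w h
  Run-gain {h} {r} (last refl _) 0≤r r≤1 n = subst₂ _≤_
    (solve 3 (λ w r E → w :* ((con (ℤ.+ 1) :- r) :* E) := (w :- (r :* w :+ con (ℤ.+ 0))) :* E)
      refl (w h) r (expPoly n r))
    (*-identityʳ (w h)) (*-monoˡ-≤ (0≤w h) (expPoly-bound 0≤r n))
  Run-gain {h} (next {h′ = h′} {r} {p} {out = out} w′≤w _ 0≤p pw 0<r′ _ run) 0≤r r≤1 n =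
    -- Both sides are multiplied by w h′ = (1 - p) w h to avoid the quotient. `S≤w′` makes the
    -- factor in front of `expPoly-shift` nonnegative.
    *-cancelˡ-≤ (0<w h′) (subst₂ _≤_ lhs (*-comm (w h) (w h′)) (≤-trans
      (*-monoˡ-≤ (*-nonNeg (0≤w h) (0≤-difference S≤w′)) (expPoly-shift (proj₁ 0<r′) 0≤p n))
      (subst (_≤ w h * w h′) (sym (*-assoc (w h) _ _))
        (*-monoˡ-≤ (0≤w h) (Run-gain run (proj₁ 0<r′) r′≤1 n)))))
    where
    S = weightedSum out w
    r′≤1 : r - p ≤ 1#
    r′≤1 = remaining≤1 0≤p r≤1
    S≤w′ : S ≤ w h′
    S≤w′ = ≤-by-difference (+-mono-≤ (Run-bound run (proj₁ 0<r′) λ _ wi≤w′ _ → wi≤w′)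
                                     (*-nonNeg (0≤-difference r′≤1) (0≤w h′)))
      (solve 3 (λ S r w → S :+ (r :* w :+ (con (ℤ.+ 1) :- r) :* w) := w :+ (S :+ con (ℤ.+ 0)))
        refl S (r - p) (w h′))
    E = expPoly n r
    lhs : w h * (w h′ - S) * ((1# - p) * expPoly n (r - p + p)) ≡ w h′ * ((w h - (p * w h + S)) * E)
    lhs = begin
      w h * (w h′ - S) * ((1# - p) * expPoly n (r - p + p))
        ≡⟨ cong (λ z → w h * (w h′ - S) * ((1# - p) * expPoly n z))
             (solve 2 (λ r p → r :- p :+ p := r) refl r p) ⟩
      w h * (w h′ - S) * ((1# - p) * E)
        ≡⟨ solve 5 (λ w w′ S p E → w :* (w′ :- S) :* ((con (ℤ.+ 1) :- p) :* E) :=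
             (w :- p :* w) :* ((w′ :- S) :* E)) refl (w h) (w h′) S p E ⟩
      (w h - p * w h) * ((w h′ - S) * E)
        ≡⟨ cong (λ z → (w h - z) * ((w h′ - S) * E)) pw ⟩
      (w h - (w h - w h′)) * ((w h′ - S) * E)
        ≡⟨ solve 4 (λ w w′ S E → (w :- (w :- w′)) :* ((w′ :- S) :* E) :=
             w′ :* ((w :- (w :- w′ :+ S)) :* E)) refl (w h) (w h′) S E ⟩
      w h′ * ((w h - (w h - w h′ + S)) * E)
        ≡⟨ cong (λ z → w h′ * ((w h - (z + S)) * E)) (sym pw) ⟩
      w h′ * ((w h - (p * w h + S)) * E) ∎
      where open ≡-Reasoning

  -- From the loop to a run.

  Ahead : Pos → List Pos → Set
  Ahead h H = ∀ {x} → x ∈ H → ¬ StrictlyDominated x → w x ≤ w h × d x ℕ.≤ d h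

  HeaviestUndominated : List Pos → Pos → Set
  HeaviestUndominated H = HeaviestAmong (λ x → x ∈ H × ¬ StrictlyDominated x)

  -- `Ahead` is the loop invariant that makes weights and deadlines of the chosen packets
  -- nonincreasing. A kept candidate is no heavier than h′ by the choice of h′; not being dominated
  -- by h′, it must then expire earlier.
  Ahead-next : ∀ {H h′} → HeaviestUndominated H h′ → Ahead h′ (removeDominated h′ H)
  Ahead-next {H} {h′} (_ , heaviest) {x} x∈H′ ¬sd =
    wx≤w′ , ℕₚ.<⇒≤ (ℕₚ.≰⇒> λ d′≤dx → proj₂ x∈H,undom (wx≤w′ , d′≤dx))
    where
    x∈H,undom = ∈-filter⁻ (λ y → ¬? (dominatedBy? (pkt y) (pkt h′))) {xs = H} x∈H′
    wx≤w′ = heaviest x (proj₁ x∈H,undom , ¬sd)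

  dominated-or-kept : ∀ {H j} h′ → j ∈ H → DominatedBy (pkt j) (pkt h′) ⊎ j ∈ removeDominated h′ H
  dominated-or-kept {j = j} h′ j∈H with dominatedBy? (pkt j) (pkt h′)
  ... | yes dom = inj₁ dom
  ... | no ¬dom = inj₂ (∈-filter⁺ (λ y → ¬? (dominatedBy? (pkt y) (pkt h′))) j∈H ¬dom)

  -- The loop ends only when H is empty, so j is eventually dominated by a chosen packet, and these
  -- are no heavier than h.
  Loop-weight : ∀ {h r H out k j} → Ahead h H → Loop h r H out k → j ∈ H → w j ≤ w h
  Loop-weight ahead (iterate {h′ = h′} heaviest loop) j∈H =
    ≤-trans (wj≤w′ (dominated-or-kept h′ j∈H)) (proj₁ (ahead h′∈H ¬sd))
    where
    h′∈H = proj₁ (proj₁ heaviest)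
    ¬sd  = proj₂ (proj₁ heaviest)
    wj≤w′ : _ → _
    wj≤w′ (inj₁ dom)  = proj₁ dom
    wj≤w′ (inj₂ j∈H′) = Loop-weight (Ahead-next heaviest) loop j∈H′

  [1-w′/w]*w : ∀ h h′ → (1# - w h′ / w h) * w h ≡ w h - w h′
  [1-w′/w]*w h h′ = trans
    (solve 2 (λ q w → (con (ℤ.+ 1) :- q) :* w := w :- q :* w) refl (w h′ / w h) (w h))
    (cong (λ z → w h - z) (/-*-cancel (w h′) (positive⇒nonZero (0<w h))))

  0≤1-w′/w : ∀ h h′ → w h′ ≤ w h → 0# ≤ 1# - w h′ / w h
  0≤1-w′/w h h′ w′≤w = *-cancelˡ-≤ (0<w h) (subst₂ _≤_ (sym (zeroʳ (w h)))
    (trans (sym ([1-w′/w]*w h h′)) (*-comm _ (w h))) (0≤-difference w′≤w))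

  remaining≤0 : ∀ {r q} → 0# ≤ q → r ≤ 0# → r - min q r ≤ 0#
  remaining≤0 {r} {q} 0≤q r≤0 with min q r | min-sel q r
  ... | _ | inj₁ refl = ≤-by-difference (+-mono-≤ 0≤q r≤0)
    (solve 2 (λ q r → r :- q :+ (q :+ con (ℤ.+ 0)) := con (ℤ.+ 0) :+ (con (ℤ.+ 0) :+ r)) refl q r)
  ... | _ | inj₂ refl = ≤-reflexive (solve 1 (λ r → r :- r := con (ℤ.+ 0)) refl r)

  count-yes : ∀ {x y} {k : ℕ} → x < y → (if does (x <? y) then suc k else k) ≡ suc k
  count-yes {x} {y} {k} x<y = cong (if_then suc k else k) (dec-true (x <? y) x<y)

  count-no : ∀ {x y} {k : ℕ} → ¬ (x < y) → (if does (x <? y) then suc k else k) ≡ k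
  count-no {x} {y} {k} x≮y = cong (if_then suc k else k) (dec-false (x <? y) x≮y)

  -- Once the remaining probability is used up it never becomes positive again, so later iterations
  -- leave the counter alone.
  Loop-count-0 : ∀ {h r H out k} → r ≤ 0# → Ahead h H → Loop h r H out k → k ≡ 0
  Loop-count-0 r≤0 ahead exit = refl
  Loop-count-0 {h} {r} r≤0 ahead (iterate {h′ = h′} heaviest loop)
    with 0# <? (r - min (1# - w h′ / w h) r)
  ... | yes (0≤r′ , 0≢r′) = contradiction (antisym 0≤r′ r′≤0) 0≢r′
    where
    w′≤w = proj₁ (ahead (proj₁ (proj₁ heaviest)) (proj₂ (proj₁ heaviest)))
    r′≤0 = remaining≤0 (0≤1-w′/w h h′ w′≤w) r≤0
  ... | no ¬0<r′ = trans (count-no ¬0<r′) (Loop-count-0 (≮⇒≥ ¬0<r′) (Ahead-next heaviest) loop)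

  -- The extra one in `suc k` stands for h itself, which was counted by the iteration that chose it.
  Loop⇒Run : ∀ {h r H out k} → 0# < r → Ahead h H → Loop h r H out k → Run h r H (take (suc k) out)
  Loop⇒Run 0<r ahead exit = last refl λ ()
  Loop⇒Run {h} {r} 0<r ahead (iterate {H = H} {h′ = h′} {out} {k} heaviest loop)
    with 0# <? (r - min (1# - w h′ / w h) r)
  ... | yes 0<r′ = subst (λ i → Run h r H (take (suc i) ((min q r , h) ∷ out))) (sym (count-yes 0<r′))
        (next w′≤w d′≤d 0≤p pw 0<r′ (dominated-or-kept h′) (Loop⇒Run 0<r′ (Ahead-next heaviest) loop))
    where
    q = 1# - w h′ / w h
    w′≤w = proj₁ (ahead (proj₁ (proj₁ heaviest)) (proj₂ (proj₁ heaviest)))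
    d′≤d = proj₂ (ahead (proj₁ (proj₁ heaviest)) (proj₂ (proj₁ heaviest)))
    p≡q : min q r ≡ q
    p≡q with min-sel q r
    ... | inj₁ eq = eq
    -- If the minimum were r, no probability would remain.
    ... | inj₂ eq = contradiction
          (sym (trans (cong (λ z → r - z) eq) (solve 1 (λ r → r :- r := con (ℤ.+ 0)) refl r)))
          (proj₂ 0<r′)
    0≤p = subst (0# ≤_) (sym p≡q) (0≤1-w′/w h h′ w′≤w)
    pw  = trans (cong (_* w h) p≡q) ([1-w′/w]*w h h′)
  ... | no ¬0<r′ = subst (λ i → Run h r H (take (suc i) ((min q r , h) ∷ out)))
        (sym (trans (count-no ¬0<r′) (Loop-count-0 (≮⇒≥ ¬0<r′) (Ahead-next heaviest) loop)))
        (last p≡r light)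
    where
    q = 1# - w h′ / w h
    p≡r : min q r ≡ r
    p≡r = antisym (min≤ʳ q r) (≤-by-difference (≮⇒≥ ¬0<r′)
      (solve 2 (λ r p → r :+ con (ℤ.+ 0) := p :+ (r :- p)) refl r (min q r)))
    r≤q : r ≤ q
    r≤q = subst (_≤ q) p≡r (min≤ˡ q r)
    wj≤w′ : ∀ {j} → DominatedBy (pkt j) (pkt h′) ⊎ j ∈ removeDominated h′ H → w j ≤ w h′
    wj≤w′ (inj₁ dom)  = proj₁ dom
    wj≤w′ (inj₂ j∈H′) = Loop-weight (Ahead-next heaviest) loop j∈H′
    -- From r ≤ q = 1 - w h′ / w h follows w h′ ≤ (1 - r) w h, and nothing in H is heavier than h′.
    light : ∀ {j} → j ∈ H → w j ≤ w h - r * w h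
    light {j} j∈H = ≤-by-difference
      (+-mono-≤ (wj≤w′ (dominated-or-kept h′ j∈H))
        (subst₂ _≤_ (*-comm (w h) r) (trans (*-comm (w h) q) ([1-w′/w]*w h h′))
          (*-monoˡ-≤ (0≤w h) r≤q)))
      (solve 4 (λ j w w′ x → j :+ (w′ :+ (w :- w′)) := w :- x :+ (j :+ x))
        refl (w j) (w h) (w h′) (r * w h))

  -- The distribution's total mass 1 forces p₀ = 0.
  Loop⇒Run₁ : ∀ {h₀ p₀ r₀ H out n} → Loop h₀ r₀ H ((p₀ , h₀) ∷ out) n → total (take n out) ≡ 1# →
    ∃₂ λ h₁ H₁ → Run h₁ 1# H₁ (take n out) × (∀ {j} → j ∈ H → DominatedBy (pkt j) (pkt h₁) ⊎ j ∈ H₁)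
  Loop⇒Run₁ exit 0≡1′ = contradiction 0≡1′ 0≢1
  Loop⇒Run₁ {h₀} {r₀ = r₀} {H} {out} (iterate {h′ = h₁} heaviest loop) total≡1
    with 0# <? (r₀ - min (1# - w h₁ / w h₀) r₀)
  ... | yes 0<r = h₁ , H₁ , normalise run total≡1 , dominated-or-kept h₁
    where
    H₁ = removeDominated h₁ H
    r₁ = r₀ - min (1# - w h₁ / w h₀) r₀
    -- The mass of a run is its initial remaining probability, so total mass 1 forces r₁ = 1.
    normalise : ∀ {l} → Run h₁ r₁ H₁ l → total l ≡ 1# → Run h₁ 1# H₁ l
    normalise run eq = subst (λ r → Run h₁ r H₁ _) (trans (sym (Run-total run)) eq) run
    run = subst (λ i → Run h₁ r₁ H₁ (take i out)) (sym (count-yes 0<r))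
      (Loop⇒Run 0<r (Ahead-next heaviest) loop)
  ... | no ¬0<r = contradiction (trans (cong (λ i → total (take i out)) (sym count≡0)) total≡1) 0≢1
    where count≡0 = trans (count-no ¬0<r) (Loop-count-0 (≮⇒≥ ¬0<r) (Ahead-next heaviest) loop)

-- Permutations, for comparing two ways of taking a packet out of a buffer.

two-heads : ∀ {A : Set} {x y : A} {xs ys} → x ∷ xs ↭ y ∷ ys →
  (x ≡ y × xs ↭ ys) ⊎ ∃ λ zs → xs ↭ y ∷ zs × ys ↭ x ∷ zs
two-heads {x = x} {y} {xs} {ys} p with ∈-resp-↭ (↭-sym p) (here refl)
... | here refl  = inj₁ (refl , drop-∷ p)
... | there y∈xs with ∈-∃++ y∈xs
...   | as , bs , refl = inj₂ (as ++ bs , xs↭ ,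
          drop-∷ (↭-trans (↭-sym p) (↭-trans (prep x xs↭) (swap x y ↭-refl))))
  where
  xs↭ : as ++ y ∷ bs ↭ y ∷ as ++ bs
  xs↭ = shift y as bs

removeAt-↭ : ∀ {A : Set} (xs : List A) i → xs ↭ lookup xs i ∷ removeAt xs i
removeAt-↭ (x ∷ xs) zero    = ↭-refl
removeAt-↭ (x ∷ xs) (suc i) = ↭-trans (prep x (removeAt-↭ xs i)) (swap x _ ↭-refl)

-- Embeddings of buffers up to a debt.

module Embeddings (R : Reals) where
  open Reals R
  open OrderedField R
  open BufferManagement R
  open Penalties R

  -- A debt of ε pays for turning xs into a part of c: packets of xs are forgone or
  -- exchanged for distinct packets of c expiring no earlier.
  infix 4 _⊑_[_]
  data _⊑_[_] : Buffer → Buffer → ℝ → Set where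
    empty  : ∀ {c ε} → 0# ≤ ε → [] ⊑ c [ ε ]

    forgo  : ∀ {x xs c δ ε} → weight x + δ ≤ ε → xs ⊑ c [ δ ] → x ∷ xs ⊑ c [ ε ]

    exchange : ∀ {x xs c y c′ δ ε} → c ↭ y ∷ c′ → deadline x ℕ.≤ deadline y →
      weight x + δ ≤ weight y + ε → δ ≤ ε → xs ⊑ c′ [ δ ] → x ∷ xs ⊑ c [ ε ]

  0≤debt : ∀ {xs c ε} → xs ⊑ c [ ε ] → 0# ≤ ε
  0≤debt (empty 0≤ε)          = 0≤ε
  0≤debt (forgo {x} x≤ s)     = ≤-trans (+-nonNeg (0≤weight x) (0≤debt s)) x≤
  0≤debt (exchange _ _ _ δ≤ s) = ≤-trans (0≤debt s) δ≤

  ⊑-respʳ-↭ : ∀ {xs c c′ δ} → c ↭ c′ → xs ⊑ c [ δ ] → xs ⊑ c′ [ δ ]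
  ⊑-respʳ-↭ c↭c′ (empty 0≤δ)                    = empty 0≤δ
  ⊑-respʳ-↭ c↭c′ (forgo x≤ s)                   = forgo x≤ (⊑-respʳ-↭ c↭c′ s)
  ⊑-respʳ-↭ c↭c′ (exchange c↭ dx≤dy x≤ δ≤ s) = exchange (↭-trans (↭-sym c↭c′) c↭) dx≤dy x≤ δ≤ s

  ⊑-addʳ : ∀ {xs c δ} y → xs ⊑ c [ δ ] → xs ⊑ y ∷ c [ δ ]
  ⊑-addʳ y (empty 0≤δ)                    = empty 0≤δ
  ⊑-addʳ y (forgo x≤ s)                   = forgo x≤ (⊑-addʳ y s)
  ⊑-addʳ y (exchange c↭ dx≤dy x≤ δ≤ s) =
    exchange (↭-trans (prep y c↭) (swap y _ ↭-refl)) dx≤dy x≤ δ≤ (⊑-addʳ y s)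

  ⊑-++ˡ : ∀ {xs c δ} zs → xs ⊑ c [ δ ] → xs ⊑ zs ++ c [ δ ]
  ⊑-++ˡ []       s = s
  ⊑-++ˡ (z ∷ zs) s = ⊑-addʳ z (⊑-++ˡ zs s)

  ⊑-refl : ∀ {ε} → 0# ≤ ε → ∀ xs → xs ⊑ xs [ ε ]
  ⊑-refl 0≤ε []       = empty 0≤ε
  ⊑-refl 0≤ε (x ∷ xs) = exchange ↭-refl ℕₚ.≤-refl ≤-refl ≤-refl (⊑-refl 0≤ε xs)

  ⊑-++ʳ : ∀ {xs c δ} zs → xs ⊑ c [ δ ] → xs ++ zs ⊑ c ++ zs [ δ ]
  ⊑-++ʳ {c = c} zs (empty 0≤δ)               = ⊑-++ˡ c (⊑-refl 0≤δ zs)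
  ⊑-++ʳ zs (forgo x≤ s)                   = forgo x≤ (⊑-++ʳ zs s)
  ⊑-++ʳ zs (exchange c↭ dx≤dy x≤ δ≤ s) = exchange (++⁺ʳ zs c↭) dx≤dy x≤ δ≤ (⊑-++ʳ zs s)

  ⊑-weaken : ∀ {xs c δ ε} → δ ≤ ε → xs ⊑ c [ δ ] → xs ⊑ c [ ε ]
  ⊑-weaken δ≤ε (empty 0≤δ)                    = empty (≤-trans 0≤δ δ≤ε)
  ⊑-weaken δ≤ε (forgo x≤ s)                   = forgo (≤-trans x≤ δ≤ε) s
  ⊑-weaken δ≤ε (exchange c↭ dx≤dy x≤ δ≤ s) =
    exchange c↭ dx≤dy (≤-trans x≤ (+-monoʳ-≤ _ δ≤ε)) (≤-trans δ≤ δ≤ε) s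

  -- If f is the partner of some x, that x is forgone instead: its exchange gave weight x + δ ≤
  -- weight f + ε. All other pairs survive.
  ⊑-forgo : ∀ {xs c f c₀ δ} → xs ⊑ c [ δ ] → c ↭ f ∷ c₀ → xs ⊑ c₀ [ δ + weight f ]
  ⊑-forgo {f = f} {δ = δ} (empty 0≤δ) c↭f = empty (+-nonNeg 0≤δ (0≤weight f))
  ⊑-forgo {f = f} (forgo {x} {δ = δ} {ε} x≤ s) c↭f = forgo (≤-by-difference x≤
    (solve 4 (λ x δ f ε → x :+ (δ :+ f) :+ ε := ε :+ f :+ (x :+ δ)) refl (weight x) δ (weight f) ε))
    (⊑-forgo s c↭f)
  ⊑-forgo {f = f} (exchange {x} {y = y} {δ = δ} {ε} c↭y dx≤dy x≤ δ≤ s) c↭f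
    with two-heads (↭-trans (↭-sym c↭y) c↭f)
  ... | inj₁ (refl , c′↭c₀) =
        forgo (≤-trans x≤ (≤-reflexive (+-comm _ _))) (⊑-respʳ-↭ c′↭c₀ s)
  ... | inj₂ (_ , c′↭ , c₀↭) = exchange c₀↭ dx≤dy
        (≤-by-difference x≤
          (solve 5 (λ x δ f y ε → x :+ (δ :+ f) :+ (y :+ ε) := y :+ (ε :+ f) :+ (x :+ δ))
          refl (weight x) δ (weight f) (weight y) ε))
        (+-mono-≤ δ≤ ≤-refl) (⊑-forgo s c′↭)

  -- The packet paired with f, if any, is paired with y instead, and κ covers the additional loss in
  -- weight.
  ⊑-exchange : ∀ {xs c f c₀ y δ κ} → 0# ≤ κ → deadline f ℕ.≤ deadline y → weight f ≤ weight y + κ →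
    xs ⊑ c [ δ ] → c ↭ f ∷ c₀ → xs ⊑ y ∷ c₀ [ δ + κ ]
  ⊑-exchange {δ = δ} {κ} 0≤κ df≤dy f≤y+κ (empty 0≤δ) c↭f = empty (+-nonNeg 0≤δ 0≤κ)
  ⊑-exchange {κ = κ} 0≤κ df≤dy f≤y+κ (forgo {x} {δ = δ} {ε} x≤ s) c↭f = forgo (≤-by-difference x≤
    (solve 4 (λ x δ f ε → x :+ (δ :+ f) :+ ε := ε :+ f :+ (x :+ δ)) refl (weight x) δ κ ε))
    (⊑-exchange 0≤κ df≤dy f≤y+κ s c↭f)
  ⊑-exchange {f = f} {y = y} {κ = κ} 0≤κ df≤dy f≤y+κ
    (exchange {x} {y = z} {δ = δ} {ε} c↭z dx≤dz x≤ δ≤ s) c↭f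
    with two-heads (↭-trans (↭-sym c↭z) c↭f)
  ... | inj₁ (refl , c′↭c₀) = exchange ↭-refl (ℕₚ.≤-trans dx≤dz df≤dy)
        (≤-by-difference (+-mono-≤ x≤ f≤y+κ)
          (solve 6 (λ x δ f ε y κ → x :+ δ :+ (f :+ ε :+ (y :+ κ)) := y :+ (ε :+ κ) :+ (x :+ δ :+ f))
            refl (weight x) δ (weight f) ε (weight y) κ))
        (≤-trans δ≤ (x≤x+y 0≤κ))
        (⊑-respʳ-↭ c′↭c₀ s)
  ... | inj₂ (_ , c′↭ , c₀↭) = exchange (↭-trans (prep y c₀↭) (swap y z ↭-refl)) dx≤dz
        (≤-by-difference x≤
          (solve 5 (λ x δ f y ε → x :+ (δ :+ f) :+ (y :+ ε) := y :+ (ε :+ f) :+ (x :+ δ))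
          refl (weight x) δ κ (weight z) ε))
        (+-mono-≤ δ≤ ≤-refl) (⊑-exchange 0≤κ df≤dy f≤y+κ s c′↭)

  -- The imitated adversary sends y and the algorithm sends f. Unless the packets coincide, the
  -- buffers left are f and y, respectively, on top of a common c₀, so f is exchanged for y, or
  -- forgone if y expires before f.
  ⊑-penalty : ∀ {xs c c₁ c₂ y f δ} → c ↭ y ∷ c₁ → c ↭ f ∷ c₂ → xs ⊑ c₁ [ δ ] →
    xs ⊑ c₂ [ δ + penalty y f ]
  ⊑-penalty {c₁ = c₁} {c₂} {y} {f} {δ} c↭y c↭f s with two-heads (↭-trans (↭-sym c↭y) c↭f)
  ... | inj₁ (refl , c₁↭c₂) = ⊑-respʳ-↭ c₁↭c₂ (⊑-weaken (x≤x+y (0≤penalty y y)) s)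
  ... | inj₂ (c₀ , c₁↭ , c₂↭) = ⊑-respʳ-↭ (↭-sym c₂↭) paid
    where
    paid : _ ⊑ y ∷ c₀ [ δ + penalty y f ]
    paid with deadline f ℕₚ.≤? deadline y | weight f ≤? weight y
    ... | no  _     | _       = ⊑-addʳ y (⊑-forgo s c₁↭)
    ... | yes df≤dy | yes f≤y = ⊑-exchange ≤-refl df≤dy (subst (_ ≤_) (sym (+-identityʳ _)) f≤y) s c₁↭
    ... | yes df≤dy | no  f≰y = ⊑-exchange (0≤-difference (≰⇒≥ f≰y)) df≤dy
            (≤-reflexive (solve 2 (λ f y → f := y :+ (f :- y)) refl (weight f) (weight y))) s c₁↭

  age-mono : ∀ x y → deadline x ℕ.≤ deadline y → age x ≡ nothing ⊎
    ∃₂ λ x′ y′ → age x ≡ just x′ × age y ≡ just y′ × weight x′ ≡ weight x × weight y′ ≡ weight y ×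
      deadline x′ ℕ.≤ deadline y′
  age-mono record { deadline = suc zero } y _ = inj₁ refl
  age-mono record { deadline = suc (suc _) } record { deadline = suc (suc _) } (ℕ.s≤s d≤) =
    inj₂ (_ , _ , refl , refl , refl , refl , d≤)
  age-mono record { deadline = suc (suc _) } record { deadline = suc zero } (ℕ.s≤s ())

  -- A partner expires no earlier than its x. If x expires, the pair dissolves, its y is at most a
  -- surplus packet, and δ ≤ ε in `exchange` keeps the debt sufficient.
  ⊑-age : ∀ {xs c δ} → xs ⊑ c [ δ ] → mapMaybe age xs ⊑ mapMaybe age c [ δ ]
  ⊑-age (empty 0≤δ) = empty 0≤δ
  ⊑-age (forgo {x} {δ = δ} {ε} x≤ s) with age-mono x x ℕₚ.≤-refl
  ... | inj₁ eq rewrite eq = ⊑-weaken (≤-by-difference (+-mono-≤ x≤ (0≤weight x))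
          (solve 3 (λ x δ ε → δ :+ (ε :+ x) := ε :+ (x :+ δ :+ con (ℤ.+ 0)))
            refl (weight x) δ ε)) (⊑-age s)
  ... | inj₂ (_ , _ , eq , _ , wx , _) rewrite eq =
        forgo (subst (λ z → z + δ ≤ ε) (sym wx) x≤) (⊑-age s)
  ⊑-age {c = c} (exchange {x} {y = y} {c′} {δ} {ε} c↭y dx≤dy x≤ δ≤ s) with age-mono x y dx≤dy
  ... | inj₁ eq rewrite eq = ⊑-weaken δ≤ (⊑-respʳ-↭ (↭-sym (mapMaybe-↭ age c↭y)) s′)
    where
    s′ : _ ⊑ mapMaybe age (y ∷ c′) [ δ ]
    s′ with age y
    ... | nothing = ⊑-age s
    ... | just y′ = ⊑-addʳ y′ (⊑-age s)
  ... | inj₂ (_ , y′ , eq , eq′ , wx , wy , d≤) rewrite eq = exchange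
          (subst (mapMaybe age c ↭_) (cong (λ m → catMaybes (m ∷ map age c′)) eq′)
            (mapMaybe-↭ age c↭y)) d≤
          (subst₂ (λ a b → a + δ ≤ b + ε) (sym wx) (sym wy) x≤) δ≤ (⊑-age s)

  -- The result of a move by the owner of b′, where b′ ⊑ b [ ε ]: it is imitated by
  -- the owner of b transmitting either nothing or y.
  data Imitated (b : Buffer) (ε gained : ℝ) (b′ : Buffer) : Set where
    idle  : ∀ {δ} → b′ ⊑ b [ δ ] → gained + δ ≤ ε → Imitated b ε gained b′
    sends : ∀ {δ y c} → b ↭ y ∷ c → b′ ⊑ c [ δ ] →
      gained + δ ≤ weight y + ε → Imitated b ε gained b′

  -- Sending a packet further down changes the debt of the tail from δ to δ′. The pair in front
  -- keeps its own contribution ε - δ.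
  exchange-rescaled : ∀ {x xs c z c′ δ δ′ ε} → c ↭ z ∷ c′ → deadline x ℕ.≤ deadline z →
    weight x + δ ≤ weight z + ε → δ ≤ ε → xs ⊑ c′ [ δ′ ] → x ∷ xs ⊑ c [ δ′ + (ε - δ) ]
  exchange-rescaled {x} {z = z} {δ = δ} {δ′} {ε} c↭ dx≤dz x≤ δ≤ = exchange c↭ dx≤dz
    (≤-by-difference x≤
      (solve 5 (λ x z δ′ δ ε → x :+ δ′ :+ (z :+ ε) := z :+ (δ′ :+ (ε :- δ)) :+ (x :+ δ))
        refl (weight x) (weight z) δ′ δ ε))
    (≤-by-difference δ≤
      (solve 3 (λ δ′ δ ε → δ′ :+ ε := δ′ :+ (ε :- δ) :+ δ) refl δ′ δ ε))

  -- A forgone packet has its weight in the debt, so its gain is paid by releasing that part while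
  -- the imitation idles. An exchanged packet is imitated by sending its partner.
  imitate-removeAt : ∀ {xs b ε} → xs ⊑ b [ ε ] → ∀ i →
    Imitated b ε (weight (lookup xs i)) (removeAt xs i)
  imitate-removeAt (forgo x≤ s)                 zero = idle s x≤
  imitate-removeAt (exchange c↭ _ x≤ _ s) zero = sends c↭ s x≤
  imitate-removeAt {x ∷ xs} (forgo {δ = δ} {ε} x≤ s) (suc i) with imitate-removeAt s i
  ... | idle {δ′} s′ g≤ = idle (forgo ≤-refl s′) (≤-by-difference (+-mono-≤ g≤ x≤)
          (solve 5 (λ g x δ′ δ ε → g :+ (x :+ δ′) :+ (δ :+ ε) := ε :+ (g :+ δ′ :+ (x :+ δ)))
            refl _ (weight x) δ′ δ ε))
  ... | sends {δ′} {y} c↭ s′ g≤ = sends c↭ (forgo ≤-refl s′) (≤-by-difference (+-mono-≤ g≤ x≤)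
          (solve 6 (λ g x δ′ δ ε y → g :+ (x :+ δ′) :+ (y :+ δ :+ ε) := y :+ ε :+ (g :+ δ′ :+ (x :+ δ)))
            refl _ (weight x) δ′ δ ε (weight y)))
  imitate-removeAt {x ∷ xs} (exchange {y = z} {δ = δ} {ε} c↭z dx≤dz x≤ δ≤ s) (suc i)
    with imitate-removeAt s i
  ... | idle {δ′} s′ g≤ = idle (exchange-rescaled c↭z dx≤dz x≤ δ≤ s′) (≤-by-difference g≤
          (solve 4 (λ g δ′ δ ε → g :+ (δ′ :+ (ε :- δ)) :+ δ := ε :+ (g :+ δ′)) refl _ δ′ δ ε))
  ... | sends {δ′} {y} c↭y s′ g≤ =
        sends (↭-trans c↭z (↭-trans (prep z c↭y) (swap z y ↭-refl)))
          (exchange-rescaled ↭-refl dx≤dz x≤ δ≤ s′)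
          (≤-by-difference g≤
            (solve 5 (λ g δ′ δ ε y → g :+ (δ′ :+ (ε :- δ)) :+ (y :+ δ) := y :+ ε :+ (g :+ δ′))
              refl _ δ′ δ ε (weight y)))

  imitate : ∀ {b′ b ε} → b′ ⊑ b [ ε ] → (m : Move b′) → Imitated b ε (gain b′ m) (send b′ m)
  imitate s nothing  = idle s (≤-reflexive (+-identityˡ _))
  imitate s (just i) = imitate-removeAt s i

-- Amortised analysis over all steps.

module Competitiveness (R : Reals) where
  open Reals R
  open OrderedField R
  open ExponentialSeries R
  open WeightedSums R
  open BufferManagement R
  open Euler R
  open Penalties R
  open Embeddings R
  open MIX-R-Step using (Loop)

  -- This collects what the amortisation needs from one step. For MIX-R the common bound `top` is
  -- w₁: it dominates the expected cost whether the imitated adversary idles or sends, and the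
  -- algorithm earns the fraction `c` of it.
  record StepBound (b : Buffer) (l : List (ℝ × Fin (length b))) : Set where
    field
      top         : ℝ
      bounds-idle : weightedSum l (weight ∘ lookup b) ≤ top
      bounds-send : ∀ j → weight (lookup b j) +
                          weightedSum l (penalty (lookup b j) ∘ lookup b) ≤ top
      earned      : c * top ≤ weightedSum l (weight ∘ lookup b)

  MIX-R-StepBound : ∀ {b h₀ p₀ out n} → Loop b h₀ 1# (allFin (length b)) ((p₀ , h₀) ∷ out) n →
    total (take n out) ≡ 1# → StepBound b (take n out)
  MIX-R-StepBound {b} loop total≡1 with MIX-R-Run.Loop⇒Run₁ R b loop total≡1
  ... | h₁ , H₁ , run , covered = record
    { top         = w h₁
    ; bounds-idle = ≤-trans (Run-bound run 0≤1 λ _ w≤ _ → w≤) (≤-reflexive (*-identityˡ _))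
    ; bounds-send = λ j → Run-penalty-covered run 0≤1 ≤-refl (covered (∈-allFin j))
    ; earned      = c*-bound (0≤w h₁) (Run-gain run 0≤1 ≤-refl)
    }
    where
    open MIX-R-Run R b using (Run-bound; Run-penalty-covered; Run-gain; 0≤w)
    open MIX-R-Step b using (w)

  -- g is the adversary's gain in the step, A i and B i are the later gains of the adversary and
  -- of the algorithm after the algorithm sends i, and the debt changes from ε to δ + cost i.
  step-paid : ∀ b {l : List (ℝ × Fin (length b))} {g δ ε v} →
    All (λ o → 0# ≤ proj₁ o) l → total l ≡ 1# →
    (cost A B : Fin (length b) → ℝ) →
    (∀ i → c * A i ≤ B i + c * (δ + cost i)) →
    g + (δ + weightedSum l cost) ≤ v + ε →
    c * v ≤ weightedSum l (weight ∘ lookup b) →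
    c * weightedSum l (λ i → g + A i) ≤ weightedSum l (λ i → weight (lookup b i) + B i) + c * ε
  step-paid b {l} {g} {δ} {ε} {v} 0≤ps total≡1 cost A B A≤B paid earned =
    subst (_≤ weightedSum l (λ i → wt i + B i) + c * ε) (weightedSum-* l c (λ i → g + A i))
      (≤-trans (weightedSum-mono 0≤ps pointwise)
        (≤-trans (≤-reflexive expand)
          (≤-by-difference (+-mono-≤ (*-monoˡ-≤ 0≤c paid) earned) arith)))
    where
    wt : Fin (length b) → ℝ
    wt i = weight (lookup b i)
    pointwise : ∀ i → c * (g + A i) ≤ c * (g + δ) + (c * cost i + B i)
    pointwise i = ≤-by-difference (A≤B i)
      (solve 6 (λ c g A B δ x → c :* (g :+ A) :+ (B :+ c :* (δ :+ x)) :=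
        c :* (g :+ δ) :+ (c :* x :+ B) :+ c :* A) refl c g (A i) (B i) δ (cost i))
    expand : weightedSum l (λ i → c * (g + δ) + (c * cost i + B i)) ≡
             c * (g + δ) + (c * weightedSum l cost + weightedSum l B)
    expand = trans (weightedSum-+ l _ _) (cong₂ _+_
      (trans (weightedSum-const l _) (trans (cong (c * (g + δ) *_) total≡1) (*-identityʳ _)))
      (trans (weightedSum-+ l _ B) (cong (_+ weightedSum l B) (weightedSum-* l c cost))))
    arith : c * (g + δ) + (c * weightedSum l cost + weightedSum l B) +
              (c * (v + ε) + weightedSum l wt) ≡
            weightedSum l (λ i → wt i + B i) + c * ε +
              (c * (g + (δ + weightedSum l cost)) + c * v)
    arith = trans
      (solve 8 (λ c g δ x b v ε w →
          c :* (g :+ δ) :+ (c :* x :+ b) :+ (c :* (v :+ ε) :+ w) :=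
          w :+ b :+ c :* ε :+ (c :* (g :+ (δ :+ x)) :+ c :* v))
        refl c g δ (weightedSum l cost) (weightedSum l B) v ε (weightedSum l wt))
      (cong (λ z → z + c * ε + (c * (g + (δ + weightedSum l cost)) + c * v))
        (sym (weightedSum-+ l wt B)))

  -- If the imitation idles, the packet f sent by the algorithm is forgone and the debt grows by
  -- w_f. If it sends y, the debt grows by `penalty y f`.
  step-bound : ∀ {b l b′ ε} → StepBound b l → All (λ o → 0# ≤ proj₁ o) l → total l ≡ 1# →
    b′ ⊑ b [ ε ] → (m′ : Move b′) (A B : Fin (length b) → ℝ) →
    (∀ i δ → send b′ m′ ⊑ removeAt b i [ δ ] → c * A i ≤ B i + c * δ) →
    c * weightedSum l (λ i → gain b′ m′ + A i) ≤
      weightedSum l (λ i → weight (lookup b i) + B i) + c * ε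
  step-bound {b} {l} {ε = ε} bound 0≤ps total≡1 s m′ A B A≤B with imitate s m′
  ... | idle {δ} s′ g≤ = step-paid b {v = top} 0≤ps total≡1 _ A B
          (λ i → A≤B i _ (⊑-forgo s′ (removeAt-↭ b i)))
          (≤-by-difference (+-mono-≤ g≤ bounds-idle)
            (solve 5 (λ g δ x ε t → g :+ (δ :+ x) :+ (ε :+ t) := t :+ ε :+ (g :+ δ :+ x))
              refl _ δ _ ε top)) earned
    where open StepBound bound
  ... | sends {δ} {y} b↭y s′ g≤ = step-paid b {v = top} 0≤ps total≡1 _ A B
          (λ i → A≤B i _ (⊑-penalty b↭y (removeAt-↭ b i) s′))
          (≤-by-difference (+-mono-≤ g≤ bounds-y)
            (solve 6 (λ g δ x ε t y → g :+ (δ :+ x) :+ (y :+ ε :+ t) := t :+ ε :+ (g :+ δ :+ (y :+ x)))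
              refl _ δ _ ε top (weight y))) earned
    where
    open StepBound bound
    y∈b = ∈-resp-↭ (↭-sym b↭y) (here refl)
    bounds-y : weight y + weightedSum l (penalty y ∘ lookup b) ≤ top
    bounds-y = subst (λ z → weight z + weightedSum l (penalty z ∘ lookup b) ≤ top)
      (sym (lookup-index y∈b)) (bounds-send (index y∈b))

  MIX-R-step : ∀ {b o b′ ε} → MIX-R-Move b o → All (λ o → 0# ≤ proj₁ o) o → total o ≡ 1# →
    b′ ⊑ b [ ε ] → (m′ : Move b′) (A B : Move b → ℝ) →
    (∀ m δ → send b′ m′ ⊑ send b m [ δ ] → c * A m ≤ B m + c * δ) →
    c * weightedSum o (λ m → gain b′ m′ + A m) ≤ weightedSum o (λ m → gain b m + B m) + c * ε
  MIX-R-step {ε = ε} idle _ _ s m′ A B A≤B with imitate s m′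
  -- With nothing pending for the algorithm, the imitation has no packet to send.
  ... | sends []↭y∷c _ _ = contradiction (↭-sym []↭y∷c) ¬x∷xs↭[]
  ... | idle {δ} s′ g≤   = ≤-by-difference (+-mono-≤ (A≤B nothing δ s′) (*-monoˡ-≤ 0≤c g≤))
    (solve 6 (λ c g A B δ ε →
        c :* (con (ℤ.+ 1) :* (g :+ A) :+ con (ℤ.+ 0)) :+ (B :+ c :* δ :+ c :* ε) :=
        con (ℤ.+ 1) :* (con (ℤ.+ 0) :+ B) :+ con (ℤ.+ 0) :+ c :* ε :+ (c :* A :+ c :* (g :+ δ)))
      refl c _ (A nothing) (B nothing) δ ε)
  MIX-R-step {b} {b′ = b′} {ε} (transmit {out = out} {n} _ loop) 0≤ps total≡1 s m′ A B A≤B =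
    subst₂ (λ x y → c * x ≤ y + c * ε)
      (sym (weightedSum-map just l (λ m → gain b′ m′ + A m)))
      (sym (weightedSum-map just l (λ m → gain b m + B m)))
      (step-bound (MIX-R-StepBound loop total-l) (map⁻ 0≤ps) total-l s m′ (A ∘ just) (B ∘ just)
        (A≤B ∘ just))
    where
    l = take n out
    total-l : total l ≡ 1#
    total-l = trans (sym (total-map just l)) total≡1

  module _ (alg : Algorithm) (isMIX-R : IsMIX-R alg) (inj : Injections) (adv : AnsweringEntity) where

    -- Potential argument with potential `c * ε`. Injections extend both buffers by the same packets
    -- and ageing preserves the embedding, so the debt changes only through transmissions. Each
    -- random outcome continues with its own debt.
    amortised : ∀ T h {bALG bADV ε} → bADV ⊑ bALG [ ε ] →
      c * expectedGainFrom alg inj adv ADV T h bALG bADV ≤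
        expectedGainFrom alg inj adv ALG T h bALG bADV + c * ε
    amortised zero    h {ε = ε} s = ≤-by-difference (*-monoˡ-≤ 0≤c (0≤debt s))
      (solve 2 (λ c ε → c :* con (ℤ.+ 0) :+ c :* ε := con (ℤ.+ 0) :+ c :* ε :+ c :* con (ℤ.+ 0))
        refl c ε)
    amortised (suc T) h {bALG} {bADV} s =
      MIX-R-step (isMIX-R h b) (nonNegative (alg h b)) (total≡1 (alg h b))
        (⊑-++ʳ (inj h) s) (adv h (bADV ++ inj h))
        (λ m → expectedGainFrom alg inj adv ADV T ((inj h , Maybe.map toℕ m) ∷ h) _ _)
        (λ m → expectedGainFrom alg inj adv ALG T ((inj h , Maybe.map toℕ m) ∷ h) _ _)
        (λ m δ s′ → amortised T _ (⊑-age s′))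
      where b = bALG ++ inj h

    competitive : (λ T → (1# / (e / (e - 1#))) * expectedGain alg inj adv ADV T) ≤ˢᵘᵖ
                  expectedGain alg inj adv ALG
    -- Both buffers start empty with debt 0, so the potential vanishes and the bound holds for every
    -- T separately.
    competitive B ALG≤B T = ≤-trans (amortised T [] (empty ≤-refl))
      (≤-trans (≤-reflexive (trans (cong (expectedGain alg inj adv ALG T +_) (zeroʳ c))
                                   (+-identityʳ _)))
        (ALG≤B T))

mainTheorem2 : (R : Reals) →
  let open Reals R
      open Euler R
      open BufferManagement R
  in (alg : Algorithm) → IsMIX-R alg → (e / (e - 1#)) -Competitive alg
mainTheorem2 R alg isMIX-R = Competitiveness.competitive R alg isMIX-R
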